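{- Let $n,m$ be positive integers with $n$ even, and let $S_n(m)=\sum_{\nu=0}^{m-1}\nu^n$. Then for $r=1$ and for $r=2$, \[ m^{r+1}\mid S_n(m)\iff m^r\mid B_n . \]
   Context: $B_n$ are the Bernoulli numbers, $\frac{z}{e^z-1}=\sum_{n\ge0}B_n\frac{z^n}{n!}$. Writing $B_n=\Lambda_n/V_n$ in lowest terms with $V_n>0$, the statement $m^r\mid B_n$ means $m^r\mid \Lambda_n$ (the numerator). -}

module Defs where

open import Data.Nat as ℕ using (ℕ; zero; suc)
open import Data.Nat.Combinatorics using (_C_)
open import Data.Integer as ℤ using (ℤ; +_)
open import Data.Rational as ℚ using (ℚ; _/_; _+_; _*_; -_; 0ℚ; 1ℚ)
open import Data.List using (upTo; map)
open import Data.Nat.ListAction using (sum)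
open import Data.Fin using (Fin)
open import Data.Vec as Vec using (Vec; []; _∷_; lookup; allFin; _∷ʳ_)

-- Bernoulli numbers with convention z/(e^z-1), i.e. B₁ = -1/2, via the
-- standard recurrence  Σ_{k=0}^{n} C(n+1,k) B_k = 0  (n ≥ 1), B₀ = 1:
--   B_n = -(1/(n+1)) Σ_{k<n} C(n+1,k) B_k .

private
  partial : (n : ℕ) → Vec ℚ n → ℚ
  partial n v = Vec.foldr _ _+_ 0ℚ
    (Vec.map (λ k → ((+ ((suc n) C (Data.Fin.toℕ k))) / 1) * lookup v k) (allFin n))

bernoulliTable : (n : ℕ) → Vec ℚ n
bernoulliTable zero = []
bernoulliTable (suc zero) = 1ℚ ∷ []
bernoulliTable (suc (suc n)) =
  bernoulliTable (suc n) Vec.∷ʳ (- ((+ 1 / suc (suc n)) * partial (suc n) (bernoulliTable (suc n))))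

bernoulli : ℕ → ℚ
bernoulli n = lookup (bernoulliTable (suc n)) (Data.Fin.fromℕ n)

powerSum : ℕ → ℕ → ℕ
powerSum n m = sum (map (λ ν → ν ℕ.^ n) (upTo m))

{-# OPTIONS --safe #-}
module Submission where

-- Faulhaber's formula reads Sₙ(m) = m Bₙ + Σ_{k ≥ 1} C(n,k) Bₙ₋ₖ mᵏ⁺¹/(k+1), and m Bⱼ is m-integral for every j.
-- Modulo m only m Bₙ survives for even n, so under either hypothesis Bₙ is m-integral; taking the modulus to be
-- 2 or 3 then shows that m is prime to 6. For such m the terms with k ≥ 3 vanish mod m³, the term k = 1 vanishes
-- because Bₙ₋₁ = 0 (apart from n = 2), and the term k = 2 vanishes mod m², which settles r = 1. For r = 2 one
-- needs n Bₙ₋₂ to be p-integral for each prime p ∣ m. If it were not, then p ∤ Sₙ₋₂(p), so aⁿ⁻² ≡ 1 mod p for all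
-- units a; but p ∣ Bₙ, i.e. p² ∣ Sₙ(p), and Voronoi's congruence with multiplier 2 turns this into p ∣ n.

open import Defs
open import Data.Nat as ℕ using (ℕ; zero; suc; s≤s; z≤n)
open import Data.Nat.Combinatorics as Comb using (_C_)
open import Data.Nat.Coprimality as Cop using (Coprime)
open import Data.Nat.Divisibility as Div
  using (_∣_; divides; ∣-refl; ∣-trans; ∣-reflexive; m∣m*n; n∣m*n; 1∣_; *-monoˡ-∣; *-monoʳ-∣; *-cancelˡ-∣; ∣m+n∣m⇒∣n)
open import Data.Nat.DivMod as DM using (_%_; m≡m%n+[m/n]*n; %-distribˡ-*; m%n%n≡m%n; m%n<n; [m+kn]%n≡m%n; m<n⇒m%n≡m)
open import Data.Nat.GCD using (gcd; gcd[m,n]∣m; gcd[m,n]∣n; gcd[m,n]≢0; module Bézout)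
open import Data.Nat.Induction using (<-rec)
open import Data.Nat.ListAction using (sum)
open import Data.Nat.ListAction.Properties using (sum-++)
open import Data.Nat.Primality
  using (Prime; _Rough_; rough⇒≤; rough∧∣⇒rough; 2-rough; ∤⇒rough-suc; euclidsLemma; prime⇒irreducible; prime⇒nonZero; prime⇒nonTrivial)
open import Data.Nat.Primality.Factorisation using (factorise)
import Data.Nat.Properties as ℕₚ
open import Data.Nat.Tactic.RingSolver using () renaming (solve-∀ to ℕ-solve-∀)
open import Data.Integer as ℤ using (ℤ; +_)
open import Data.Integer.Divisibility using () renaming (_∣_ to _∣ℤ_)
import Data.Integer.Properties as ℤₚ
open import Data.Integer.Tactic.RingSolver using () renaming (solve-∀ to ℤ-solve-∀)
open import Data.Rational as ℚ using (ℚ; 0ℚ; 1ℚ; _/_; ↥_; ↧ₙ_) renaming (_+_ to _⊕_; _*_ to _⊗_; -_ to ⊖_)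
import Data.Rational.Properties as ℚₚ
import Data.Rational.Unnormalised as ℚᵘ
import Data.Rational.Unnormalised.Properties as ℚᵘₚ
open import Data.Sign as Sign using ()
open import Data.Fin as Fin using (Fin)
open import Data.Fin.Permutation using (Permutation′; permutation)
import Data.Fin.Properties as Finₚ
open import Data.List as List using ([]; _∷_)
import Data.List.Properties as Listₚ
open import Data.List.Relation.Unary.All using (_∷_)
open import Data.Vec as Vec using (Vec; []; _∷_; lookup; tabulate)
open import Data.Product using (∃; _×_; _,_; proj₁; proj₂)
open import Data.Sum using (_⊎_; inj₁; inj₂; [_,_]′)
open import Algebra.Properties.CommutativeMonoid.Sum ℕₚ.+-0-commutativeMonoid
  using (sum-permute; sum-init-last; sum-cong-≗) renaming (sum to sumFin)
open import Algebra.Properties.Group ℚₚ.+-0-group using () renaming (∙-cancelʳ to ⊕-cancelʳ)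
open import Function using (_∘_; id)
open import Function.Bundles using (_⇔_; mk⇔; module Equivalence)
open import Relation.Binary.PropositionalEquality
open import Relation.Nullary using (Dec; yes; no; ¬_; contradiction)
open import Relation.Nullary.Decidable using (dec⇒maybe)
open import Tactic.RingSolver using (solve-∀)
import Tactic.RingSolver.Core.AlmostCommutativeRing as ACR
open ≡-Reasoning

-- Exponential generating series

-- The tail of Faulhaber's formula cannot be estimated uniformly in m: a denominator k + 1 may share
-- factors with m, so each further power of m requires knowledge about m that only the preceding
-- congruence provides. Hence the three levels k = 0, 1, 2 of `powerSum⇔bernoulli`: level 0 holds
-- for every m and gives m prime to 6, which opens the estimate mod m²; level 1 then gives m ∣ Bₙ,
-- which opens the estimate mod m³. Either side at one level implies a side at the level below, so
-- both directions can climb. The last estimate is delicate at primes p ≥ 5 with p - 1 ∣ n - 2,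
-- where p divides the denominator of Bₙ₋₂. There Kummer's congruence reads Bₙ/n ≡ B₂/2 = 1/12 mod
-- p, a unit, so p ∣ Bₙ forces p ∣ n. Voronoi's congruence proves just this instance: for the
-- multiplier 2 the quotients ⌊2j/p⌋ are 0 or 1, so the sum that remains runs over odd numbers and
-- can be evaluated.

ℚ-ring : ACR.AlmostCommutativeRing _ _
ℚ-ring = ACR.fromCommutativeRing ℚₚ.+-*-commutativeRing (λ x → dec⇒maybe (0ℚ ℚₚ.≟ x))

⊕-interchange : ∀ a b c d → (a ⊕ b) ⊕ (c ⊕ d) ≡ (a ⊕ c) ⊕ (b ⊕ d)
⊕-interchange = solve-∀ ℚ-ring

toℚᵘ-/ : ∀ i n .{{_ : ℕ.NonZero n}} → ℚ.toℚᵘ (i / n) ℚᵘ.≃ (i ℚᵘ./ n)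
toℚᵘ-/ i n@(suc n-1) = ℚₚ.toℚᵘ-fromℚᵘ (ℚᵘ.mkℚᵘ i n-1)

opaque
  ι : ℤ → ℚ
  ι i = i / 1

  ι-def : ∀ i → ι i ≡ i / 1
  ι-def i = refl

  ι-+ : ∀ i j → ι (i ℤ.+ j) ≡ ι i ⊕ ι j
  ι-+ i j = ℚₚ.toℚᵘ-injective (ℚᵘₚ.≃-trans (toℚᵘ-/ (i ℤ.+ j) 1) (ℚᵘₚ.≃-trans
    (ℚᵘ.*≡* (lem i j))
    (ℚᵘₚ.≃-sym (ℚᵘₚ.≃-trans (ℚₚ.toℚᵘ-homo-+ (ι i) (ι j)) (ℚᵘₚ.+-cong (toℚᵘ-/ i 1) (toℚᵘ-/ j 1))))))
    where
    lem : ∀ i j → (i ℤ.+ j) ℤ.* ℤ.1ℤ ≡ (i ℤ.* ℤ.1ℤ ℤ.+ j ℤ.* ℤ.1ℤ) ℤ.* ℤ.1ℤ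
    lem = ℤ-solve-∀

  ι-* : ∀ i j → ι (i ℤ.* j) ≡ ι i ⊗ ι j
  ι-* i j = ℚₚ.toℚᵘ-injective (ℚᵘₚ.≃-trans (toℚᵘ-/ (i ℤ.* j) 1)
    (ℚᵘₚ.≃-sym (ℚᵘₚ.≃-trans (ℚₚ.toℚᵘ-homo-* (ι i) (ι j)) (ℚᵘₚ.*-cong (toℚᵘ-/ i 1) (toℚᵘ-/ j 1)))))

  ι-injective : ∀ {i j} → ι i ≡ ι j → i ≡ j
  ι-injective {i} {j} eq = trans (sym (ℤₚ.*-identityʳ i))
    (trans (ℚᵘₚ.drop-*≡* (ℚᵘₚ.≃-trans (ℚᵘₚ.≃-sym (toℚᵘ-/ i 1))
      (ℚᵘₚ.≃-trans (ℚᵘₚ.≃-reflexive (cong ℚ.toℚᵘ eq)) (toℚᵘ-/ j 1)))) (ℤₚ.*-identityʳ j))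

  ι-1 : ι (+ 1) ≡ 1ℚ
  ι-1 = refl

  ι-0 : ι (+ 0) ≡ 0ℚ
  ι-0 = refl

  ⊗-/ : ∀ i d .{{_ : ℕ.NonZero d}} → ι (+ d) ⊗ (i / d) ≡ ι i
  ⊗-/ i d@(suc _) = ℚₚ.toℚᵘ-injective (ℚᵘₚ.≃-trans
    (ℚᵘₚ.≃-trans (ℚₚ.toℚᵘ-homo-* (ι (+ d)) (i / d)) (ℚᵘₚ.*-cong (toℚᵘ-/ (+ d) 1) (toℚᵘ-/ i d)))
    (ℚᵘₚ.≃-trans (ℚᵘ.*≡* (lem (+ d) i)) (ℚᵘₚ.≃-sym (toℚᵘ-/ i 1))))
    where
    lem : ∀ d i → (d ℤ.* i) ℤ.* ℤ.1ℤ ≡ i ℤ.* (ℤ.1ℤ ℤ.* d)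
    lem = ℤ-solve-∀

ν : ℕ → ℚ
ν n = ι (+ n)

ν-+ : ∀ m n → ν (m ℕ.+ n) ≡ ν m ⊕ ν n
ν-+ m n = trans (cong ι (ℤₚ.pos-+ m n)) (ι-+ (+ m) (+ n))

ν-* : ∀ m n → ν (m ℕ.* n) ≡ ν m ⊗ ν n
ν-* m n = trans (cong ι (ℤₚ.pos-* m n)) (ι-* (+ m) (+ n))

ν-suc : ∀ n → ν (suc n) ≡ 1ℚ ⊕ ν n
ν-suc n = trans (ν-+ 1 n) (cong (_⊕ ν n) ι-1)

⊗-cancel-ν : ∀ d .{{_ : ℕ.NonZero d}} {x y} → ν d ⊗ x ≡ ν d ⊗ y → x ≡ y
⊗-cancel-ν d {x} {y} eq = trans (sym (undo x)) (trans (cong ((+ 1 / d) ⊗_) eq) (undo y))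
  where
  undo : ∀ x → (+ 1 / d) ⊗ (ν d ⊗ x) ≡ x
  undo x = begin
    (+ 1 / d) ⊗ (ν d ⊗ x) ≡⟨ sym (ℚₚ.*-assoc (+ 1 / d) (ν d) x) ⟩
    (+ 1 / d) ⊗ ν d ⊗ x   ≡⟨ cong (_⊗ x) (ℚₚ.*-comm (+ 1 / d) (ν d)) ⟩
    ν d ⊗ (+ 1 / d) ⊗ x   ≡⟨ cong (_⊗ x) (trans (⊗-/ (+ 1) d) ι-1) ⟩
    1ℚ ⊗ x                ≡⟨ ℚₚ.*-identityˡ x ⟩
    x                     ∎

-- A sequence f stands for its exponential generating function Σ fₙ zⁿ/n!; then shifting is
-- differentiation, and the product is determined by the Leibniz rule.
Series : Set
Series = ℕ → ℚ

infixl 7 _⋆_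

_⋆_ : Series → Series → Series
(f ⋆ g) zero    = f 0 ⊗ g 0
(f ⋆ g) (suc n) = (f ∘ suc ⋆ g) n ⊕ (f ⋆ (g ∘ suc)) n

⋆-cong : ∀ {f f′ g g′} → f ≗ f′ → g ≗ g′ → f ⋆ g ≗ f′ ⋆ g′
⋆-cong p q zero    = cong₂ _⊗_ (p 0) (q 0)
⋆-cong p q (suc n) = cong₂ _⊕_ (⋆-cong (p ∘ suc) q n) (⋆-cong p (q ∘ suc) n)

⋆-comm : ∀ f g → f ⋆ g ≗ g ⋆ f
⋆-comm f g zero    = ℚₚ.*-comm (f 0) (g 0)
⋆-comm f g (suc n) = trans (cong₂ _⊕_ (⋆-comm (f ∘ suc) g n) (⋆-comm f (g ∘ suc) n)) (ℚₚ.+-comm ((g ⋆ (f ∘ suc)) n) ((g ∘ suc ⋆ f) n))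

⋆-distribʳ : ∀ f g h → (λ k → f k ⊕ g k) ⋆ h ≗ λ k → (f ⋆ h) k ⊕ (g ⋆ h) k
⋆-distribʳ f g h zero    = ℚₚ.*-distribʳ-+ (h 0) (f 0) (g 0)
⋆-distribʳ f g h (suc n) = trans
  (cong₂ _⊕_ (⋆-distribʳ (f ∘ suc) (g ∘ suc) h n) (⋆-distribʳ f g (h ∘ suc) n))
  (⊕-interchange ((f ∘ suc ⋆ h) n) ((g ∘ suc ⋆ h) n) ((f ⋆ (h ∘ suc)) n) ((g ⋆ (h ∘ suc)) n))

⋆-distribˡ : ∀ f g h → f ⋆ (λ k → g k ⊕ h k) ≗ λ k → (f ⋆ g) k ⊕ (f ⋆ h) k
⋆-distribˡ f g h n = begin
  (f ⋆ (λ k → g k ⊕ h k)) n ≡⟨ ⋆-comm f _ n ⟩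
  ((λ k → g k ⊕ h k) ⋆ f) n ≡⟨ ⋆-distribʳ g h f n ⟩
  (g ⋆ f) n ⊕ (h ⋆ f) n     ≡⟨ cong₂ _⊕_ (⋆-comm g f n) (⋆-comm h f n) ⟩
  (f ⋆ g) n ⊕ (f ⋆ h) n     ∎

⋆-scaleˡ : ∀ c f g → (λ k → c ⊗ f k) ⋆ g ≗ λ k → c ⊗ (f ⋆ g) k
⋆-scaleˡ c f g zero    = ℚₚ.*-assoc c (f 0) (g 0)
⋆-scaleˡ c f g (suc n) = trans
  (cong₂ _⊕_ (⋆-scaleˡ c (f ∘ suc) g n) (⋆-scaleˡ c f (g ∘ suc) n))
  (sym (ℚₚ.*-distribˡ-+ c _ _))

⋆-scaleʳ : ∀ c f g → f ⋆ (λ k → c ⊗ g k) ≗ λ k → c ⊗ (f ⋆ g) k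
⋆-scaleʳ c f g n = begin
  (f ⋆ (λ k → c ⊗ g k)) n ≡⟨ ⋆-comm f _ n ⟩
  ((λ k → c ⊗ g k) ⋆ f) n ≡⟨ ⋆-scaleˡ c g f n ⟩
  c ⊗ (g ⋆ f) n           ≡⟨ cong (c ⊗_) (⋆-comm g f n) ⟩
  c ⊗ (f ⋆ g) n           ∎

⋆-assoc : ∀ f g h → f ⋆ g ⋆ h ≗ f ⋆ (g ⋆ h)
⋆-assoc f g h zero    = ℚₚ.*-assoc (f 0) (g 0) (h 0)
⋆-assoc f g h (suc n) = begin
  ((f ⋆ g) ∘ suc ⋆ h) n ⊕ (f ⋆ g ⋆ (h ∘ suc)) n
    ≡⟨ cong (_⊕ (f ⋆ g ⋆ (h ∘ suc)) n) (⋆-distribʳ (f ∘ suc ⋆ g) (f ⋆ (g ∘ suc)) h n) ⟩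
  ((f ∘ suc ⋆ g ⋆ h) n ⊕ (f ⋆ (g ∘ suc) ⋆ h) n) ⊕ (f ⋆ g ⋆ (h ∘ suc)) n
    ≡⟨ cong₂ _⊕_ (cong₂ _⊕_ (⋆-assoc (f ∘ suc) g h n) (⋆-assoc f (g ∘ suc) h n)) (⋆-assoc f g (h ∘ suc) n) ⟩
  ((f ∘ suc ⋆ (g ⋆ h)) n ⊕ (f ⋆ (g ∘ suc ⋆ h)) n) ⊕ (f ⋆ (g ⋆ (h ∘ suc))) n
    ≡⟨ ℚₚ.+-assoc ((f ∘ suc ⋆ (g ⋆ h)) n) ((f ⋆ (g ∘ suc ⋆ h)) n) ((f ⋆ (g ⋆ (h ∘ suc))) n) ⟩
  (f ∘ suc ⋆ (g ⋆ h)) n ⊕ ((f ⋆ (g ∘ suc ⋆ h)) n ⊕ (f ⋆ (g ⋆ (h ∘ suc))) n)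
    ≡⟨ cong ((f ∘ suc ⋆ (g ⋆ h)) n ⊕_) (sym (⋆-distribˡ f (g ∘ suc ⋆ h) (g ⋆ (h ∘ suc)) n)) ⟩
  (f ∘ suc ⋆ (g ⋆ h)) n ⊕ (f ⋆ ((g ⋆ h) ∘ suc)) n ∎

𝟘 𝟙 𝕏 : Series
𝟘 _ = 0ℚ
𝟙 zero    = 1ℚ
𝟙 (suc _) = 0ℚ
𝕏 zero    = 0ℚ
𝕏 (suc n) = 𝟙 n

𝟘⋆ : ∀ f → 𝟘 ⋆ f ≗ 𝟘
𝟘⋆ f zero    = ℚₚ.*-zeroˡ (f 0)
𝟘⋆ f (suc n) = cong₂ _⊕_ (𝟘⋆ f n) (𝟘⋆ (f ∘ suc) n)

𝟙⋆ : ∀ f → 𝟙 ⋆ f ≗ f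
𝟙⋆ f zero    = ℚₚ.*-identityˡ (f 0)
𝟙⋆ f (suc n) = trans (cong₂ _⊕_ (𝟘⋆ f n) (𝟙⋆ (f ∘ suc) n)) (ℚₚ.+-identityˡ (f (suc n)))

𝕏⋆ : ∀ f n → (𝕏 ⋆ f) (suc n) ≡ ν (suc n) ⊗ f n
𝕏⋆ f zero    = begin
  1ℚ ⊗ f 0 ⊕ 0ℚ ⊗ f 1 ≡⟨ cong (1ℚ ⊗ f 0 ⊕_) (ℚₚ.*-zeroˡ (f 1)) ⟩
  1ℚ ⊗ f 0 ⊕ 0ℚ       ≡⟨ ℚₚ.+-identityʳ _ ⟩
  1ℚ ⊗ f 0            ≡⟨ cong (_⊗ f 0) (sym ι-1) ⟩
  ν 1 ⊗ f 0           ∎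
𝕏⋆ f (suc n) = begin
  (𝟙 ⋆ f) (suc n) ⊕ (𝕏 ⋆ (f ∘ suc)) (suc n) ≡⟨ cong₂ _⊕_ (𝟙⋆ f (suc n)) (𝕏⋆ (f ∘ suc) n) ⟩
  f (suc n) ⊕ ν (suc n) ⊗ f (suc n)         ≡⟨ lem (f (suc n)) (ν (suc n)) ⟩
  (1ℚ ⊕ ν (suc n)) ⊗ f (suc n)              ≡⟨ cong (_⊗ f (suc n)) (sym (ν-suc (suc n))) ⟩
  ν (suc (suc n)) ⊗ f (suc n)               ∎
  where
  lem : ∀ x y → x ⊕ y ⊗ x ≡ (1ℚ ⊕ y) ⊗ x
  lem = solve-∀ ℚ-ring

𝕏⋆-cancel : ∀ {f g} → 𝕏 ⋆ f ≗ 𝕏 ⋆ g → f ≗ g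
𝕏⋆-cancel {f} {g} eq n = ⊗-cancel-ν (suc n) (trans (sym (𝕏⋆ f n)) (trans (eq (suc n)) (𝕏⋆ g n)))

exp : ℚ → Series
exp c zero    = 1ℚ
exp c (suc n) = c ⊗ exp c n

exp-+ : ∀ a b → exp a ⋆ exp b ≗ exp (a ⊕ b)
exp-+ a b zero    = refl
exp-+ a b (suc n) = begin
  ((λ k → a ⊗ exp a k) ⋆ exp b) n ⊕ (exp a ⋆ (λ k → b ⊗ exp b k)) n
    ≡⟨ cong₂ _⊕_ (⋆-scaleˡ a (exp a) (exp b) n) (⋆-scaleʳ b (exp a) (exp b) n) ⟩
  a ⊗ (exp a ⋆ exp b) n ⊕ b ⊗ (exp a ⋆ exp b) n
    ≡⟨ sym (ℚₚ.*-distribʳ-+ _ a b) ⟩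
  (a ⊕ b) ⊗ (exp a ⋆ exp b) n
    ≡⟨ cong ((a ⊕ b) ⊗_) (exp-+ a b n) ⟩
  (a ⊕ b) ⊗ exp (a ⊕ b) n ∎

exp-0 : exp 0ℚ ≗ 𝟙
exp-0 zero    = refl
exp-0 (suc n) = ℚₚ.*-zeroˡ (exp 0ℚ n)

exp-ν : ∀ m n → exp (ν m) n ≡ ν (m ℕ.^ n)
exp-ν m zero    = sym ι-1
exp-ν m (suc n) = trans (cong (ν m ⊗_) (exp-ν m n)) (sym (ν-* m (m ℕ.^ n)))

-- (e^{mz} − 1)/z
expQuot : ℕ → Series
expQuot m k = + (m ℕ.^ suc k) / suc k

𝕏⋆expQuot : ∀ m n → (𝕏 ⋆ expQuot m) n ⊕ 𝟙 n ≡ exp (ν m) n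
𝕏⋆expQuot m zero    = cong (_⊕ 1ℚ) (ℚₚ.*-zeroˡ (expQuot m 0))
𝕏⋆expQuot m (suc n) = begin
  (𝕏 ⋆ expQuot m) (suc n) ⊕ 0ℚ ≡⟨ ℚₚ.+-identityʳ _ ⟩
  (𝕏 ⋆ expQuot m) (suc n)      ≡⟨ 𝕏⋆ (expQuot m) n ⟩
  ν (suc n) ⊗ expQuot m n      ≡⟨ ⊗-/ (+ (m ℕ.^ suc n)) (suc n) ⟩
  ν (m ℕ.^ suc n)              ≡⟨ sym (exp-ν m (suc n)) ⟩
  exp (ν m) (suc n)            ∎

∑ : ℕ → Series → ℚ
∑ zero    f = 0ℚ
∑ (suc n) f = f 0 ⊕ ∑ n (f ∘ suc)

∑-cong : ∀ n {f g} → (∀ k → k ℕ.< n → f k ≡ g k) → ∑ n f ≡ ∑ n g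
∑-cong zero    eq = refl
∑-cong (suc n) eq = cong₂ _⊕_ (eq 0 (s≤s z≤n)) (∑-cong n (λ k k<n → eq (suc k) (s≤s k<n)))

∑-+ : ∀ n f g → ∑ n (λ k → f k ⊕ g k) ≡ ∑ n f ⊕ ∑ n g
∑-+ zero    f g = refl
∑-+ (suc n) f g = trans (cong (f 0 ⊕ g 0 ⊕_) (∑-+ n (f ∘ suc) (g ∘ suc))) (⊕-interchange (f 0) (g 0) (∑ n (f ∘ suc)) (∑ n (g ∘ suc)))

∑-last : ∀ n f → ∑ (suc n) f ≡ ∑ n f ⊕ f n
∑-last zero    f = ℚₚ.+-comm (f 0) 0ℚ
∑-last (suc n) f = trans (cong (f 0 ⊕_) (∑-last n (f ∘ suc))) (sym (ℚₚ.+-assoc (f 0) _ _))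

-- Leibniz's rule of order n, read off at z = 0; the induction step is Pascal's rule.
⋆-∑ : ∀ f g n → (f ⋆ g) n ≡ ∑ (suc n) (λ k → ν (n C k) ⊗ (f k ⊗ g (n ℕ.∸ k)))
⋆-∑ f g zero    = trans (sym (trans (cong (_⊗ (f 0 ⊗ g 0)) ι-1) (ℚₚ.*-identityˡ (f 0 ⊗ g 0)))) (sym (ℚₚ.+-identityʳ (ν (0 C 0) ⊗ (f 0 ⊗ g 0))))
⋆-∑ f g (suc n) = begin
  (f ∘ suc ⋆ g) n ⊕ (f ⋆ (g ∘ suc)) n
    ≡⟨ cong₂ _⊕_ (⋆-∑ (f ∘ suc) g n) (⋆-∑ f (g ∘ suc) n) ⟩
  A ⊕ ∑ (suc n) (λ k → ν (n C k) ⊗ (f k ⊗ g (suc (n ℕ.∸ k))))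
    ≡⟨ cong (A ⊕_) (∑-cong (suc n) λ k k≤n →
         cong (λ j → ν (n C k) ⊗ (f k ⊗ g j)) (sym (ℕₚ.+-∸-assoc 1 (ℕₚ.≤-pred k≤n)))) ⟩
  A ⊕ ∑ (suc n) (λ k → ν (n C k) ⊗ t k)
    -- The sum is lengthened by the term k = n + 1, whose coefficient `n C suc n` is 0; once k = 0
    -- is split off, its range agrees with that of `A`.
    ≡⟨ cong (A ⊕_) (sym lastVanishes) ⟩
  A ⊕ (ν (n C 0) ⊗ t 0 ⊕ B)
    ≡⟨ rearrange A (ν (n C 0) ⊗ t 0) B ⟩
  ν (n C 0) ⊗ t 0 ⊕ (A ⊕ B)
    ≡⟨ cong (ν (n C 0) ⊗ t 0 ⊕_) (sym (∑-+ (suc n) (λ k → ν (n C k) ⊗ t (suc k)) (λ k → ν (n C suc k) ⊗ t (suc k)))) ⟩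
  ν (n C 0) ⊗ t 0 ⊕ ∑ (suc n) (λ k → ν (n C k) ⊗ t (suc k) ⊕ ν (n C suc k) ⊗ t (suc k))
    ≡⟨ cong (ν (n C 0) ⊗ t 0 ⊕_) (∑-cong (suc n) λ k _ → pascal k) ⟩
  ∑ (suc (suc n)) (λ k → ν (suc n C k) ⊗ t k) ∎
  where
  t : Series
  t k = f k ⊗ g (suc n ℕ.∸ k)

  A B : ℚ
  A = ∑ (suc n) (λ k → ν (n C k) ⊗ t (suc k))
  B = ∑ (suc n) (λ k → ν (n C suc k) ⊗ t (suc k))

  rearrange : ∀ a b c → a ⊕ (b ⊕ c) ≡ b ⊕ (a ⊕ c)
  rearrange = solve-∀ ℚ-ring

  lastVanishes : ∑ (suc (suc n)) (λ k → ν (n C k) ⊗ t k) ≡ ∑ (suc n) (λ k → ν (n C k) ⊗ t k)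
  lastVanishes = begin
    ∑ (suc (suc n)) (λ k → ν (n C k) ⊗ t k) ≡⟨ ∑-last (suc n) (λ k → ν (n C k) ⊗ t k) ⟩
    D ⊕ ν (n C suc n) ⊗ t (suc n)
      ≡⟨ cong (λ c → D ⊕ c ⊗ t (suc n)) (trans (cong ν (Comb.k>n⇒nCk≡0 (ℕₚ.n<1+n n))) ι-0) ⟩
    D ⊕ 0ℚ ⊗ t (suc n) ≡⟨ cong (D ⊕_) (ℚₚ.*-zeroˡ (t (suc n))) ⟩
    D ⊕ 0ℚ             ≡⟨ ℚₚ.+-identityʳ D ⟩
    D                  ∎
    where
    D : ℚ
    D = ∑ (suc n) (λ k → ν (n C k) ⊗ t k)

  pascal : ∀ k → ν (n C k) ⊗ t (suc k) ⊕ ν (n C suc k) ⊗ t (suc k) ≡ ν (suc n C suc k) ⊗ t (suc k)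
  pascal k = begin
    ν (n C k) ⊗ t (suc k) ⊕ ν (n C suc k) ⊗ t (suc k) ≡⟨ sym (ℚₚ.*-distribʳ-+ (t (suc k)) (ν (n C k)) (ν (n C suc k))) ⟩
    (ν (n C k) ⊕ ν (n C suc k)) ⊗ t (suc k)           ≡⟨ cong (_⊗ t (suc k)) (sym (ν-+ (n C k) (n C suc k))) ⟩
    ν (n C k ℕ.+ n C suc k) ⊗ t (suc k)
      ≡⟨ cong (λ c → ν c ⊗ t (suc k)) (Comb.nCk+nC[k+1]≡[n+1]C[k+1] n k) ⟩
    ν (suc n C suc k) ⊗ t (suc k) ∎

-- Bernoulli numbers and power sums

lookup-∷ʳ-fromℕ : ∀ {A : Set} {n} (xs : Vec A n) x → lookup (xs Vec.∷ʳ x) (Fin.fromℕ n) ≡ x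
lookup-∷ʳ-fromℕ []       x = refl
lookup-∷ʳ-fromℕ (_ ∷ xs) x = lookup-∷ʳ-fromℕ xs x

lookup-∷ʳ-inject₁ : ∀ {A : Set} {n} (xs : Vec A n) x i → lookup (xs Vec.∷ʳ x) (Fin.inject₁ i) ≡ lookup xs i
lookup-∷ʳ-inject₁ (_ ∷ xs) x Fin.zero    = refl
lookup-∷ʳ-inject₁ (_ ∷ xs) x (Fin.suc i) = lookup-∷ʳ-inject₁ xs x i

-- Each step of the table only appends an entry, so entry i of a longer table is still the last
-- entry of the table of length i + 1.
lookup-bernoulliTable : ∀ n i → lookup (bernoulliTable (suc n)) i ≡ bernoulli (Fin.toℕ i)
lookup-bernoulliTable zero    Fin.zero = refl
lookup-bernoulliTable (suc n) i with Fin.toℕ i ℕ.≟ suc n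
... | yes p = begin
  lookup (bernoulliTable (suc (suc n))) i ≡⟨ cong (lookup (bernoulliTable (suc (suc n)))) (Finₚ.toℕ-injective (trans p (sym (Finₚ.toℕ-fromℕ (suc n))))) ⟩
  bernoulli (suc n)                       ≡⟨ cong bernoulli (sym p) ⟩
  bernoulli (Fin.toℕ i)                   ∎
... | no ¬p = begin
  lookup (bernoulliTable (suc (suc n))) i
    ≡⟨ cong (lookup (bernoulliTable (suc (suc n)))) (sym (Finₚ.inject₁-lower₁ i (¬p ∘ sym))) ⟩
  lookup (bernoulliTable (suc (suc n))) (Fin.inject₁ (Fin.lower₁ i (¬p ∘ sym)))
    ≡⟨ lookup-∷ʳ-inject₁ (bernoulliTable (suc n)) _ (Fin.lower₁ i (¬p ∘ sym)) ⟩
  lookup (bernoulliTable (suc n)) (Fin.lower₁ i (¬p ∘ sym))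
    ≡⟨ lookup-bernoulliTable n (Fin.lower₁ i (¬p ∘ sym)) ⟩
  bernoulli (Fin.toℕ (Fin.lower₁ i (¬p ∘ sym)))
    ≡⟨ cong bernoulli (Finₚ.toℕ-lower₁ i (¬p ∘ sym)) ⟩
  bernoulli (Fin.toℕ i) ∎

foldr-tabulate : ∀ n {A : Set} (f : A → ℚ) (h : Fin n → A) g → (∀ i → f (h i) ≡ g (Fin.toℕ i)) →
  Vec.foldr (λ _ → ℚ) _⊕_ 0ℚ (Vec.map f (tabulate h)) ≡ ∑ n g
foldr-tabulate zero    f h g eq = refl
foldr-tabulate (suc n) f h g eq = cong₂ _⊕_ (eq Fin.zero) (foldr-tabulate n f (h ∘ Fin.suc) (g ∘ suc) (eq ∘ Fin.suc))

bernoulli-suc : ∀ n → bernoulli (suc n) ≡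
  ⊖ ((+ 1 / suc (suc n)) ⊗ ∑ (suc n) (λ k → ν (suc (suc n) C k) ⊗ bernoulli k))
bernoulli-suc n = trans
  (lookup-∷ʳ-fromℕ (bernoulliTable (suc n)) _)
  (cong (λ x → ⊖ ((+ 1 / suc (suc n)) ⊗ x))
    (foldr-tabulate (suc n) (λ k → (+ (suc (suc n) C Fin.toℕ k) / 1) ⊗ lookup (bernoulliTable (suc n)) k) id
      (λ k → ν (suc (suc n) C k) ⊗ bernoulli k)
      (λ i → cong₂ _⊗_ (sym (ι-def (+ (suc (suc n) C Fin.toℕ i)))) (lookup-bernoulliTable n i))))

∑-bernoulli : ∀ n → ∑ (suc (suc n)) (λ k → ν (suc (suc n) C k) ⊗ bernoulli k) ≡ 0ℚ
∑-bernoulli n = begin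
  ∑ (suc N) (λ k → ν (suc N C k) ⊗ bernoulli k) ≡⟨ ∑-last N (λ k → ν (suc N C k) ⊗ bernoulli k) ⟩
  s ⊕ ν (suc N C N) ⊗ bernoulli N               ≡⟨ cong₂ (λ c b → s ⊕ ν c ⊗ b) C≡ (bernoulli-suc n) ⟩
  s ⊕ ν (suc N) ⊗ ⊖ ((+ 1 / suc N) ⊗ s)         ≡⟨ lem s (ν (suc N)) (+ 1 / suc N) ⟩
  s ⊕ ⊖ (ν (suc N) ⊗ (+ 1 / suc N) ⊗ s)         ≡⟨ cong (λ c → s ⊕ ⊖ (c ⊗ s)) (trans (⊗-/ (+ 1) (suc N)) ι-1) ⟩
  s ⊕ ⊖ (1ℚ ⊗ s)                                ≡⟨ lem′ s ⟩
  0ℚ                                            ∎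
  where
  N = suc n
  s : ℚ
  s = ∑ N (λ k → ν (suc N C k) ⊗ bernoulli k)
  C≡ : suc N C N ≡ suc N
  C≡ = trans (Comb.nCk≡nC[n∸k] (ℕₚ.n≤1+n N)) (trans (cong (suc N C_) (ℕₚ.m+n∸n≡m 1 N)) (Comb.nC1≡n (suc N)))
  lem : ∀ s a b → s ⊕ a ⊗ ⊖ (b ⊗ s) ≡ s ⊕ ⊖ (a ⊗ b ⊗ s)
  lem = solve-∀ ℚ-ring
  lem′ : ∀ s → s ⊕ ⊖ (1ℚ ⊗ s) ≡ 0ℚ
  lem′ = solve-∀ ℚ-ring

exp-1 : ∀ n → exp 1ℚ n ≡ 1ℚ
exp-1 zero    = refl
exp-1 (suc n) = cong (1ℚ ⊗_) (exp-1 n)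

-- This is B(z)(eᶻ - 1) = z without subtraction: from index 2 on it is the recurrence `∑-bernoulli`,
-- and the two lower coefficients are computed.
bernoulli⋆exp1 : bernoulli ⋆ exp 1ℚ ≗ λ n → bernoulli n ⊕ 𝕏 n
bernoulli⋆exp1 zero          = refl
bernoulli⋆exp1 (suc zero)    = refl
bernoulli⋆exp1 (suc (suc n)) = begin
  (bernoulli ⋆ exp 1ℚ) N
    ≡⟨ ⋆-∑ bernoulli (exp 1ℚ) N ⟩
  ∑ (suc N) (λ k → ν (N C k) ⊗ (bernoulli k ⊗ exp 1ℚ (N ℕ.∸ k)))
    ≡⟨ ∑-cong (suc N) (λ k _ → cong (ν (N C k) ⊗_) (trans (cong (bernoulli k ⊗_) (exp-1 (N ℕ.∸ k))) (ℚₚ.*-identityʳ (bernoulli k)))) ⟩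
  ∑ (suc N) (λ k → ν (N C k) ⊗ bernoulli k)
    ≡⟨ ∑-last N (λ k → ν (N C k) ⊗ bernoulli k) ⟩
  ∑ N (λ k → ν (N C k) ⊗ bernoulli k) ⊕ ν (N C N) ⊗ bernoulli N
    ≡⟨ cong₂ _⊕_ (∑-bernoulli n) (trans (cong (_⊗ bernoulli N) (trans (cong ν (Comb.nCn≡1 N)) ι-1)) (ℚₚ.*-identityˡ (bernoulli N))) ⟩
  0ℚ ⊕ bernoulli N
    ≡⟨ ℚₚ.+-comm 0ℚ (bernoulli N) ⟩
  bernoulli N ⊕ 0ℚ ∎
  where N = suc (suc n)

-- Divides by eᶻ − 1 = z/B.
exp1-difference : ∀ {f h} → f ⋆ exp 1ℚ ≗ (λ n → f n ⊕ h n) → 𝕏 ⋆ f ≗ bernoulli ⋆ h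
exp1-difference {f} {h} eq n = ⊕-cancelʳ ((bernoulli ⋆ f) n) ((𝕏 ⋆ f) n) ((bernoulli ⋆ h) n) (begin
  (𝕏 ⋆ f) n ⊕ (bernoulli ⋆ f) n          ≡⟨ ℚₚ.+-comm ((𝕏 ⋆ f) n) ((bernoulli ⋆ f) n) ⟩
  (bernoulli ⋆ f) n ⊕ (𝕏 ⋆ f) n          ≡⟨ sym (⋆-distribʳ bernoulli 𝕏 f n) ⟩
  ((λ k → bernoulli k ⊕ 𝕏 k) ⋆ f) n      ≡⟨ ⋆-cong (λ k → sym (bernoulli⋆exp1 k)) (λ _ → refl) n ⟩
  (bernoulli ⋆ exp 1ℚ ⋆ f) n             ≡⟨ ⋆-assoc bernoulli (exp 1ℚ) f n ⟩
  (bernoulli ⋆ (exp 1ℚ ⋆ f)) n           ≡⟨ ⋆-cong {bernoulli} (λ _ → refl) (λ k → trans (⋆-comm (exp 1ℚ) f k) (eq k)) n ⟩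
  (bernoulli ⋆ (λ k → f k ⊕ h k)) n      ≡⟨ ⋆-distribˡ bernoulli f h n ⟩
  (bernoulli ⋆ f) n ⊕ (bernoulli ⋆ h) n  ≡⟨ ℚₚ.+-comm ((bernoulli ⋆ f) n) ((bernoulli ⋆ h) n) ⟩
  (bernoulli ⋆ h) n ⊕ (bernoulli ⋆ f) n  ∎)

powerSum-suc : ∀ n m → powerSum n (suc m) ≡ powerSum n m ℕ.+ m ℕ.^ n
powerSum-suc n m = begin
  sum (List.map f (List.upTo (suc m)))        ≡⟨ cong (sum ∘ List.map f) (sym (Listₚ.upTo-∷ʳ m)) ⟩
  sum (List.map f (List.upTo m List.∷ʳ m))    ≡⟨ cong sum (Listₚ.map-++ f (List.upTo m) (m List.∷ List.[])) ⟩
  sum (List.map f (List.upTo m) List.∷ʳ f m)  ≡⟨ sum-++ (List.map f (List.upTo m)) (f m List.∷ List.[]) ⟩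
  powerSum n m ℕ.+ (m ℕ.^ n ℕ.+ 0)            ≡⟨ cong (powerSum n m ℕ.+_) (ℕₚ.+-identityʳ (m ℕ.^ n)) ⟩
  powerSum n m ℕ.+ m ℕ.^ n                    ∎
  where
  f : ℕ → ℕ
  f ν = ν ℕ.^ n

-- The geometric sum of the e^{jz} over j < m; the coefficient at n = 0 comes out as m because 0⁰ =
-- 1.
powerSeries : ℕ → Series
powerSeries m n = ν (powerSum n m)

powerSeries-suc : ∀ m n → powerSeries (suc m) n ≡ powerSeries m n ⊕ exp (ν m) n
powerSeries-suc m n = trans (cong ν (powerSum-suc n m)) (trans (ν-+ (powerSum n m) (m ℕ.^ n)) (cong (powerSeries m n ⊕_) (sym (exp-ν m n))))

-- Multiplication by eᶻ shifts the geometric sum, which loses its first term 1 and gains e^{mz}.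
powerSeries⋆exp1 : ∀ m n → (powerSeries m ⋆ exp 1ℚ) n ⊕ 𝟙 n ≡ powerSeries m n ⊕ exp (ν m) n
powerSeries⋆exp1 zero n = begin
  (powerSeries 0 ⋆ exp 1ℚ) n ⊕ 𝟙 n ≡⟨ cong (_⊕ 𝟙 n) (trans (⋆-cong (λ _ → ι-0) (λ _ → refl) n) (𝟘⋆ (exp 1ℚ) n)) ⟩
  0ℚ ⊕ 𝟙 n                         ≡⟨ cong₂ _⊕_ (sym ι-0) (trans (sym (exp-0 n)) (cong (λ c → exp c n) (sym ι-0))) ⟩
  powerSeries 0 n ⊕ exp (ν 0) n    ∎
powerSeries⋆exp1 (suc m) n = begin
  (powerSeries (suc m) ⋆ exp 1ℚ) n ⊕ 𝟙 n
    ≡⟨ cong (_⊕ 𝟙 n) (trans (⋆-cong (powerSeries-suc m) (λ _ → refl) n) (⋆-distribʳ (powerSeries m) (exp (ν m)) (exp 1ℚ) n)) ⟩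
  ((powerSeries m ⋆ exp 1ℚ) n ⊕ (exp (ν m) ⋆ exp 1ℚ) n) ⊕ 𝟙 n
    ≡⟨ swap ((powerSeries m ⋆ exp 1ℚ) n) ((exp (ν m) ⋆ exp 1ℚ) n) (𝟙 n) ⟩
  ((powerSeries m ⋆ exp 1ℚ) n ⊕ 𝟙 n) ⊕ (exp (ν m) ⋆ exp 1ℚ) n
    ≡⟨ cong₂ _⊕_ (powerSeries⋆exp1 m n) (trans (exp-+ (ν m) 1ℚ n) (cong (λ c → exp c n) (trans (ℚₚ.+-comm (ν m) 1ℚ) (sym (ν-suc m))))) ⟩
  (powerSeries m n ⊕ exp (ν m) n) ⊕ exp (ν (suc m)) n
    ≡⟨ cong (_⊕ exp (ν (suc m)) n) (sym (powerSeries-suc m n)) ⟩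
  powerSeries (suc m) n ⊕ exp (ν (suc m)) n ∎
  where
  swap : ∀ a b c → (a ⊕ b) ⊕ c ≡ (a ⊕ c) ⊕ b
  swap = solve-∀ ℚ-ring

-- The geometric sum is (e^{mz} - 1)/(eᶻ - 1), that is, (e^{mz} - 1)/z times B(z).
faulhaber : ∀ m → powerSeries m ≗ expQuot m ⋆ bernoulli
faulhaber m = 𝕏⋆-cancel (λ n → begin
  (𝕏 ⋆ powerSeries m) n               ≡⟨ exp1-difference difference n ⟩
  (bernoulli ⋆ (𝕏 ⋆ expQuot m)) n     ≡⟨ ⋆-comm bernoulli (𝕏 ⋆ expQuot m) n ⟩
  (𝕏 ⋆ expQuot m ⋆ bernoulli) n       ≡⟨ ⋆-assoc 𝕏 (expQuot m) bernoulli n ⟩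
  (𝕏 ⋆ (expQuot m ⋆ bernoulli)) n     ∎)
  where
  difference : powerSeries m ⋆ exp 1ℚ ≗ λ n → powerSeries m n ⊕ (𝕏 ⋆ expQuot m) n
  difference n = ⊕-cancelʳ (𝟙 n) ((powerSeries m ⋆ exp 1ℚ) n) (powerSeries m n ⊕ (𝕏 ⋆ expQuot m) n) (begin
    (powerSeries m ⋆ exp 1ℚ) n ⊕ 𝟙 n               ≡⟨ powerSeries⋆exp1 m n ⟩
    powerSeries m n ⊕ exp (ν m) n                  ≡⟨ cong (powerSeries m n ⊕_) (sym (𝕏⋆expQuot m n)) ⟩
    powerSeries m n ⊕ ((𝕏 ⋆ expQuot m) n ⊕ 𝟙 n)    ≡⟨ sym (ℚₚ.+-assoc (powerSeries m n) ((𝕏 ⋆ expQuot m) n) (𝟙 n)) ⟩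
    (powerSeries m n ⊕ (𝕏 ⋆ expQuot m) n) ⊕ 𝟙 n    ∎)

-- The substitution z ↦ cz, reflection, and Bernoulli numbers of odd index

dilate : ℚ → Series → Series
dilate c f n = exp c n ⊗ f n

dilate-⋆ : ∀ c f g → dilate c (f ⋆ g) ≗ dilate c f ⋆ dilate c g
dilate-⋆ c f g zero    = lem (f 0) (g 0)
  where
  lem : ∀ x y → 1ℚ ⊗ (x ⊗ y) ≡ (1ℚ ⊗ x) ⊗ (1ℚ ⊗ y)
  lem = solve-∀ ℚ-ring
dilate-⋆ c f g (suc n) = begin
  (c ⊗ e) ⊗ ((f ∘ suc ⋆ g) n ⊕ (f ⋆ (g ∘ suc)) n)
    ≡⟨ distrib c e ((f ∘ suc ⋆ g) n) ((f ⋆ (g ∘ suc)) n) ⟩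
  c ⊗ (e ⊗ (f ∘ suc ⋆ g) n) ⊕ c ⊗ (e ⊗ (f ⋆ (g ∘ suc)) n)
    ≡⟨ cong₂ (λ x y → c ⊗ x ⊕ c ⊗ y) (dilate-⋆ c (f ∘ suc) g n) (dilate-⋆ c f (g ∘ suc) n) ⟩
  c ⊗ (dilate c (f ∘ suc) ⋆ dilate c g) n ⊕ c ⊗ (dilate c f ⋆ dilate c (g ∘ suc)) n
    ≡⟨ cong₂ _⊕_ (sym (⋆-scaleˡ c (dilate c (f ∘ suc)) (dilate c g) n)) (sym (⋆-scaleʳ c (dilate c f) (dilate c (g ∘ suc)) n)) ⟩
  ((λ k → c ⊗ dilate c (f ∘ suc) k) ⋆ dilate c g) n ⊕ (dilate c f ⋆ (λ k → c ⊗ dilate c (g ∘ suc) k)) n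
    ≡⟨ cong₂ _⊕_ (⋆-cong (λ k → sym (ℚₚ.*-assoc c (exp c k) (f (suc k)))) (λ _ → refl) n)
                 (⋆-cong {dilate c f} (λ _ → refl) (λ k → sym (ℚₚ.*-assoc c (exp c k) (g (suc k)))) n) ⟩
  (dilate c f ∘ suc ⋆ dilate c g) n ⊕ (dilate c f ⋆ (dilate c g ∘ suc)) n ∎
  where
  e : ℚ
  e = exp c n
  distrib : ∀ c e x y → (c ⊗ e) ⊗ (x ⊕ y) ≡ c ⊗ (e ⊗ x) ⊕ c ⊗ (e ⊗ y)
  distrib = solve-∀ ℚ-ring

dilate-𝕏 : ∀ c n → dilate c 𝕏 n ≡ c ⊗ 𝕏 n
dilate-𝕏 c zero          = trans (ℚₚ.*-zeroʳ 1ℚ) (sym (ℚₚ.*-zeroʳ c))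
dilate-𝕏 c (suc zero)    = cong (_⊗ 1ℚ) (ℚₚ.*-identityʳ c)
dilate-𝕏 c (suc (suc n)) = trans (ℚₚ.*-zeroʳ (c ⊗ (c ⊗ exp c n))) (sym (ℚₚ.*-zeroʳ c))

-1ℚ : ℚ
-1ℚ = ⊖ 1ℚ

-- B(−z) = B(z) + z, since both sides F satisfy F (eᶻ − 1) = z eᶻ.
bernoulli-reflect : ∀ n → dilate -1ℚ bernoulli n ≡ bernoulli n ⊕ 𝕏 n
bernoulli-reflect = 𝕏⋆-cancel (λ n → trans (exp1-difference reflected n) (sym (exp1-difference shifted n)))
  where
  B⁻ B⁺ : Series
  B⁻ = dilate -1ℚ bernoulli
  B⁺ n = bernoulli n ⊕ 𝕏 n

  shifted : B⁺ ⋆ exp 1ℚ ≗ λ n → B⁺ n ⊕ (𝕏 ⋆ exp 1ℚ) n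
  shifted n = trans (⋆-distribʳ bernoulli 𝕏 (exp 1ℚ) n) (cong (_⊕ (𝕏 ⋆ exp 1ℚ) n) (bernoulli⋆exp1 n))

  B⁻⋆exp-1 : B⁻ ⋆ exp -1ℚ ≗ λ n → B⁻ n ⊕ -1ℚ ⊗ 𝕏 n
  B⁻⋆exp-1 n = begin
    (B⁻ ⋆ exp -1ℚ) n                    ≡⟨ ⋆-cong {B⁻} (λ _ → refl) (λ k → sym (trans (cong (exp -1ℚ k ⊗_) (exp-1 k)) (ℚₚ.*-identityʳ (exp -1ℚ k)))) n ⟩
    (B⁻ ⋆ dilate -1ℚ (exp 1ℚ)) n        ≡⟨ sym (dilate-⋆ -1ℚ bernoulli (exp 1ℚ) n) ⟩
    exp -1ℚ n ⊗ (bernoulli ⋆ exp 1ℚ) n  ≡⟨ cong (exp -1ℚ n ⊗_) (bernoulli⋆exp1 n) ⟩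
    exp -1ℚ n ⊗ (bernoulli n ⊕ 𝕏 n)     ≡⟨ ℚₚ.*-distribˡ-+ (exp -1ℚ n) (bernoulli n) (𝕏 n) ⟩
    B⁻ n ⊕ dilate -1ℚ 𝕏 n               ≡⟨ cong (B⁻ n ⊕_) (dilate-𝕏 -1ℚ n) ⟩
    B⁻ n ⊕ -1ℚ ⊗ 𝕏 n                    ∎

  reflected : B⁻ ⋆ exp 1ℚ ≗ λ n → B⁻ n ⊕ (𝕏 ⋆ exp 1ℚ) n
  reflected n = begin
    (B⁻ ⋆ exp 1ℚ) n
      -- Subtracting and adding z eᶻ makes the bracket (B⁻ - z) eᶻ = B⁻ e⁻ᶻ eᶻ, where the
      -- exponentials cancel.
      ≡⟨ move ((B⁻ ⋆ exp 1ℚ) n) ((𝕏 ⋆ exp 1ℚ) n) ⟩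
    ((B⁻ ⋆ exp 1ℚ) n ⊕ -1ℚ ⊗ (𝕏 ⋆ exp 1ℚ) n) ⊕ (𝕏 ⋆ exp 1ℚ) n
      ≡⟨ cong (_⊕ (𝕏 ⋆ exp 1ℚ) n) (begin
        (B⁻ ⋆ exp 1ℚ) n ⊕ -1ℚ ⊗ (𝕏 ⋆ exp 1ℚ) n          ≡⟨ cong ((B⁻ ⋆ exp 1ℚ) n ⊕_) (sym (⋆-scaleˡ -1ℚ 𝕏 (exp 1ℚ) n)) ⟩
        (B⁻ ⋆ exp 1ℚ) n ⊕ ((λ k → -1ℚ ⊗ 𝕏 k) ⋆ exp 1ℚ) n ≡⟨ sym (⋆-distribʳ B⁻ (λ k → -1ℚ ⊗ 𝕏 k) (exp 1ℚ) n) ⟩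
        ((λ k → B⁻ k ⊕ -1ℚ ⊗ 𝕏 k) ⋆ exp 1ℚ) n            ≡⟨ ⋆-cong (λ k → sym (B⁻⋆exp-1 k)) (λ _ → refl) n ⟩
        (B⁻ ⋆ exp -1ℚ ⋆ exp 1ℚ) n                        ≡⟨ ⋆-assoc B⁻ (exp -1ℚ) (exp 1ℚ) n ⟩
        (B⁻ ⋆ (exp -1ℚ ⋆ exp 1ℚ)) n                      ≡⟨ ⋆-cong {B⁻} (λ _ → refl) (λ k → trans (exp-+ -1ℚ 1ℚ k) (exp-0 k)) n ⟩
        (B⁻ ⋆ 𝟙) n                                       ≡⟨ trans (⋆-comm B⁻ 𝟙 n) (𝟙⋆ B⁻ n) ⟩
        B⁻ n                                             ∎) ⟩
    B⁻ n ⊕ (𝕏 ⋆ exp 1ℚ) n ∎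
    where
    move : ∀ a b → a ≡ (a ⊕ -1ℚ ⊗ b) ⊕ b
    move a b = begin
      a                     ≡⟨ lem a b ⟩
      (a ⊕ ⊖ 1ℚ ⊗ b) ⊕ b  ∎
      where
      lem : ∀ a b → a ≡ (a ⊕ ⊖ 1ℚ ⊗ b) ⊕ b
      lem = solve-∀ ℚ-ring

exp-sign-odd : ∀ j → exp -1ℚ (suc (j ℕ.* 2)) ≡ -1ℚ
exp-sign-odd zero    = refl
exp-sign-odd (suc j) = cong (λ x → -1ℚ ⊗ (-1ℚ ⊗ x)) (exp-sign-odd j)

-- From index 3 on, the summand z of the reflection formula contributes nothing, and at an odd index
-- the formula reads -b = b.
bernoulli-odd : ∀ j → bernoulli (suc (suc j ℕ.* 2)) ≡ 0ℚ
bernoulli-odd j = ⊗-cancel-ν 2 (begin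
  ν 2 ⊗ b                 ≡⟨ cong (_⊗ b) (ν-+ 1 1) ⟩
  (ν 1 ⊕ ν 1) ⊗ b         ≡⟨ cong (λ x → (x ⊕ x) ⊗ b) ι-1 ⟩
  (1ℚ ⊕ 1ℚ) ⊗ b           ≡⟨ lem b ⟩
  (b ⊕ 0ℚ) ⊕ ⊖ (⊖ 1ℚ ⊗ b) ≡⟨ cong (_⊕ ⊖ (-1ℚ ⊗ b)) (sym reflect) ⟩
  -1ℚ ⊗ b ⊕ ⊖ (-1ℚ ⊗ b)   ≡⟨ ℚₚ.+-inverseʳ (-1ℚ ⊗ b) ⟩
  0ℚ                      ≡⟨ sym (ℚₚ.*-zeroʳ (ν 2)) ⟩
  ν 2 ⊗ 0ℚ                ∎)
  where
  b : ℚ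
  b = bernoulli (suc (suc j ℕ.* 2))
  lem : ∀ b → (1ℚ ⊕ 1ℚ) ⊗ b ≡ (b ⊕ 0ℚ) ⊕ ⊖ (⊖ 1ℚ ⊗ b)
  lem = solve-∀ ℚ-ring
  reflect : -1ℚ ⊗ b ≡ b ⊕ 0ℚ
  reflect = trans (cong (_⊗ b) (sym (exp-sign-odd (suc j)))) (bernoulli-reflect (suc (suc j ℕ.* 2)))

-- Divisibility in the localisation of ℤ at m

coprime-* : ∀ {a b m} → Coprime a m → Coprime b m → Coprime (a ℕ.* b) m
coprime-* {a} {b} {m} ca cb {d} (d∣ab , d∣m) = cb (Cop.coprime-divisor c d∣ab , d∣m)
  where
  c : Coprime d a
  c (e∣d , e∣a) = ca (e∣a , ∣-trans e∣d d∣m)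

coprime-^ : ∀ {a m} k → Coprime a m → Coprime (a ℕ.^ k) m
coprime-^ zero    c = Cop.1-coprimeTo _
coprime-^ (suc k) c = coprime-* c (coprime-^ k c)

-- x lies in t ℤ₍ₘ₎, where ℤ₍ₘ₎ consists of the fractions with denominator prime to m.
record LocalMultiple (m t : ℕ) (x : ℚ) : Set where
  constructor localMultiple
  field
    den      : ℕ
    num      : ℤ
    coprime  : Coprime den m
    equation : ν den ⊗ x ≡ ι (+ t ℤ.* num)

lm-ι : ∀ {m} i → LocalMultiple m 1 (ι i)
lm-ι {m} i = localMultiple 1 i (Cop.1-coprimeTo m) (sym (ι-* (+ 1) i))

lm-ν : ∀ {m t} → LocalMultiple m t (ν t)
lm-ν {m} {t} = localMultiple 1 (+ 1) (Cop.1-coprimeTo m)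
  (trans (cong (_⊗ ν t) ι-1) (trans (ℚₚ.*-identityˡ (ν t)) (cong ι (sym (ℤₚ.*-identityʳ (+ t))))))

lm-0 : ∀ {m t} → LocalMultiple m t 0ℚ
lm-0 {m} {t} = localMultiple 1 (+ 0) (Cop.1-coprimeTo m)
  (trans (ℚₚ.*-zeroʳ (ν 1)) (trans (sym ι-0) (cong ι (sym (ℤₚ.*-zeroʳ (+ t))))))

lm-* : ∀ {m s t x y} → LocalMultiple m s x → LocalMultiple m t y → LocalMultiple m (s ℕ.* t) (x ⊗ y)
lm-* {m} {s} {t} {x} {y} (localMultiple d z c eq) (localMultiple d′ z′ c′ eq′) =
  localMultiple (d ℕ.* d′) (z ℤ.* z′) (coprime-* c c′) (begin
    ν (d ℕ.* d′) ⊗ (x ⊗ y)             ≡⟨ cong (_⊗ (x ⊗ y)) (ν-* d d′) ⟩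
    (ν d ⊗ ν d′) ⊗ (x ⊗ y)             ≡⟨ lem (ν d) (ν d′) x y ⟩
    (ν d ⊗ x) ⊗ (ν d′ ⊗ y)             ≡⟨ cong₂ _⊗_ eq eq′ ⟩
    ι (+ s ℤ.* z) ⊗ ι (+ t ℤ.* z′)     ≡⟨ sym (ι-* (+ s ℤ.* z) (+ t ℤ.* z′)) ⟩
    ι (+ s ℤ.* z ℤ.* (+ t ℤ.* z′))     ≡⟨ cong ι (lem′ (+ s) z (+ t) z′) ⟩
    ι (+ s ℤ.* + t ℤ.* (z ℤ.* z′))     ≡⟨ cong (λ u → ι (u ℤ.* (z ℤ.* z′))) (sym (ℤₚ.pos-* s t)) ⟩
    ι (+ (s ℕ.* t) ℤ.* (z ℤ.* z′))     ∎)
  where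
  lem : ∀ a b x y → (a ⊗ b) ⊗ (x ⊗ y) ≡ (a ⊗ x) ⊗ (b ⊗ y)
  lem = solve-∀ ℚ-ring
  lem′ : ∀ s z t z′ → s ℤ.* z ℤ.* (t ℤ.* z′) ≡ s ℤ.* t ℤ.* (z ℤ.* z′)
  lem′ = ℤ-solve-∀

lm-+ : ∀ {m t x y} → LocalMultiple m t x → LocalMultiple m t y → LocalMultiple m t (x ⊕ y)
lm-+ {m} {t} {x} {y} (localMultiple d z c eq) (localMultiple d′ z′ c′ eq′) =
  localMultiple (d ℕ.* d′) (+ d′ ℤ.* z ℤ.+ + d ℤ.* z′) (coprime-* c c′) (begin
    ν (d ℕ.* d′) ⊗ (x ⊕ y)                             ≡⟨ cong (_⊗ (x ⊕ y)) (ν-* d d′) ⟩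
    (ν d ⊗ ν d′) ⊗ (x ⊕ y)                             ≡⟨ lem (ν d) (ν d′) x y ⟩
    ν d′ ⊗ (ν d ⊗ x) ⊕ ν d ⊗ (ν d′ ⊗ y)                ≡⟨ cong₂ (λ u v → ν d′ ⊗ u ⊕ ν d ⊗ v) eq eq′ ⟩
    ν d′ ⊗ ι (+ t ℤ.* z) ⊕ ν d ⊗ ι (+ t ℤ.* z′)
      ≡⟨ cong₂ _⊕_ (sym (ι-* (+ d′) (+ t ℤ.* z))) (sym (ι-* (+ d) (+ t ℤ.* z′))) ⟩
    ι (+ d′ ℤ.* (+ t ℤ.* z)) ⊕ ι (+ d ℤ.* (+ t ℤ.* z′))
      ≡⟨ sym (ι-+ (+ d′ ℤ.* (+ t ℤ.* z)) (+ d ℤ.* (+ t ℤ.* z′))) ⟩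
    ι (+ d′ ℤ.* (+ t ℤ.* z) ℤ.+ + d ℤ.* (+ t ℤ.* z′)) ≡⟨ cong ι (lem′ (+ d) (+ d′) (+ t) z z′) ⟩
    ι (+ t ℤ.* (+ d′ ℤ.* z ℤ.+ + d ℤ.* z′))           ∎)
  where
  lem : ∀ a b x y → (a ⊗ b) ⊗ (x ⊕ y) ≡ b ⊗ (a ⊗ x) ⊕ a ⊗ (b ⊗ y)
  lem = solve-∀ ℚ-ring
  lem′ : ∀ d d′ t z z′ → d′ ℤ.* (t ℤ.* z) ℤ.+ d ℤ.* (t ℤ.* z′) ≡ t ℤ.* (d′ ℤ.* z ℤ.+ d ℤ.* z′)
  lem′ = ℤ-solve-∀

lm-scale : ∀ {m t x} i → LocalMultiple m t x → LocalMultiple m t (ι i ⊗ x)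
lm-scale {m} {t} {x} i h = subst (λ u → LocalMultiple m u (ι i ⊗ x)) (ℕₚ.+-identityʳ t) (lm-* (lm-ι i) h)

lm-cancel-+ʳ : ∀ {m t x y} → LocalMultiple m t (x ⊕ y) → LocalMultiple m t y → LocalMultiple m t x
lm-cancel-+ʳ {m} {t} {x} {y} h k = subst (LocalMultiple m t) (begin
  (x ⊕ y) ⊕ ι ℤ.-1ℤ ⊗ y   ≡⟨ cong (λ c → (x ⊕ y) ⊕ c ⊗ y) (ι-def ℤ.-1ℤ) ⟩
  (x ⊕ y) ⊕ ⊖ 1ℚ ⊗ y    ≡⟨ lem x y ⟩
  x                     ∎) (lm-+ h (lm-scale ℤ.-1ℤ k))
  where
  lem : ∀ x y → (x ⊕ y) ⊕ ⊖ 1ℚ ⊗ y ≡ x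
  lem = solve-∀ ℚ-ring

lm-weaken : ∀ {m s t x} → s ∣ t → LocalMultiple m t x → LocalMultiple m s x
lm-weaken {m} {s} {t} {x} (divides q t≡qs) (localMultiple d z c eq) = localMultiple d (+ q ℤ.* z) c (trans eq (cong ι (begin
  + t ℤ.* z             ≡⟨ cong (λ u → + u ℤ.* z) t≡qs ⟩
  + (q ℕ.* s) ℤ.* z     ≡⟨ cong (ℤ._* z) (ℤₚ.pos-* q s) ⟩
  + q ℤ.* + s ℤ.* z     ≡⟨ lem (+ q) (+ s) z ⟩
  + s ℤ.* (+ q ℤ.* z)   ∎)))
  where
  lem : ∀ q s z → q ℤ.* s ℤ.* z ≡ s ℤ.* (q ℤ.* z)
  lem = ℤ-solve-∀

lm-restrict : ∀ {m p t x} → p ∣ m → LocalMultiple m t x → LocalMultiple p t x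
lm-restrict p∣m (localMultiple d z c eq) = localMultiple d z (λ (e∣d , e∣p) → c (e∣d , ∣-trans e∣p p∣m)) eq

lm-cancel-unit : ∀ {m t x} u → Coprime u m → LocalMultiple m t (ν u ⊗ x) → LocalMultiple m t x
lm-cancel-unit {x = x} u cu (localMultiple d z c eq) = localMultiple (d ℕ.* u) z (coprime-* c cu)
  (trans (cong (_⊗ x) (ν-* d u)) (trans (ℚₚ.*-assoc (ν d) (ν u) x) eq))

lm-cancel-* : ∀ {m t x} s .{{_ : ℕ.NonZero s}} → LocalMultiple m (s ℕ.* t) (ν s ⊗ x) → LocalMultiple m t x
lm-cancel-* {m} {t} {x} s (localMultiple d z c eq) = localMultiple d z c (⊗-cancel-ν s (begin
  ν s ⊗ (ν d ⊗ x)           ≡⟨ lem (ν s) (ν d) x ⟩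
  ν d ⊗ (ν s ⊗ x)           ≡⟨ eq ⟩
  ι (+ (s ℕ.* t) ℤ.* z)     ≡⟨ cong (λ u → ι (u ℤ.* z)) (ℤₚ.pos-* s t) ⟩
  ι (+ s ℤ.* + t ℤ.* z)     ≡⟨ cong ι (ℤₚ.*-assoc (+ s) (+ t) z) ⟩
  ι (+ s ℤ.* (+ t ℤ.* z))   ≡⟨ ι-* (+ s) (+ t ℤ.* z) ⟩
  ν s ⊗ ι (+ t ℤ.* z)       ∎))
  where
  lem : ∀ a b x → a ⊗ (b ⊗ x) ≡ b ⊗ (a ⊗ x)
  lem = solve-∀ ℚ-ring

lm-∑ : ∀ {m t} n {f} → (∀ k → k ℕ.< n → LocalMultiple m t (f k)) → LocalMultiple m t (∑ n f)
lm-∑ zero    h = lm-0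
lm-∑ (suc n) h = lm-+ (h 0 (s≤s z≤n)) (lm-∑ n (λ k k<n → h (suc k) (s≤s k<n)))

lm-ν* : ∀ {m t x} → LocalMultiple m 1 x → LocalMultiple m t (ν t ⊗ x)
lm-ν* {m} {t} {x} h = subst (λ u → LocalMultiple m u (ν t ⊗ x)) (ℕₚ.*-identityʳ t) (lm-* lm-ν h)

∣⇒lm-ν : ∀ {m t n} → t ∣ n → LocalMultiple m t (ν n)
∣⇒lm-ν {m} {n = n} t∣n = lm-weaken t∣n lm-ν

coprime-^ʳ : ∀ {a m} k → Coprime a m → Coprime (m ℕ.^ k) a
coprime-^ʳ k c = coprime-^ k (Cop.sym c)

lm-ν⇒∣ : ∀ m k {n} → LocalMultiple m (m ℕ.^ k) (ν n) → m ℕ.^ k ∣ n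
lm-ν⇒∣ m k {n} (localMultiple d z c eq) = Cop.coprime-divisor (coprime-^ʳ k c)
  (divides ℤ.∣ z ∣ (begin
    d ℕ.* n                        ≡⟨⟩
    ℤ.∣ + (d ℕ.* n) ∣              ≡⟨ cong ℤ.∣_∣ (ι-injective (trans (ν-* d n) eq)) ⟩
    ℤ.∣ + (m ℕ.^ k) ℤ.* z ∣        ≡⟨ ℤₚ.abs-* (+ (m ℕ.^ k)) z ⟩
    m ℕ.^ k ℕ.* ℤ.∣ z ∣            ≡⟨ ℕₚ.*-comm (m ℕ.^ k) ℤ.∣ z ∣ ⟩
    ℤ.∣ z ∣ ℕ.* m ℕ.^ k            ∎))

-- Reduced numerators and denominators

↧⊗ : ∀ x → ν (↧ₙ x) ⊗ x ≡ ι (↥ x)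
↧⊗ x = trans (cong (ν (↧ₙ x) ⊗_) (sym (ℚₚ.↥p/↧p≡p x))) (⊗-/ (↥ x) (↧ₙ x))

lm-numerator : ∀ {m t x} (h : LocalMultiple m t x) → let open LocalMultiple h in
  den ℕ.* ℤ.∣ ↥ x ∣ ≡ t ℕ.* (ℤ.∣ num ∣ ℕ.* ↧ₙ x)
lm-numerator {m} {t} {x} (localMultiple d z c eq) = begin
  d ℕ.* ℤ.∣ ↥ x ∣                   ≡⟨ sym (ℤₚ.abs-* (+ d) (↥ x)) ⟩
  ℤ.∣ + d ℤ.* ↥ x ∣                 ≡⟨ cong ℤ.∣_∣ (ι-injective cleared) ⟩
  ℤ.∣ + t ℤ.* z ℤ.* + ↧ₙ x ∣        ≡⟨ trans (ℤₚ.abs-* (+ t ℤ.* z) (+ ↧ₙ x)) (cong (ℕ._* ↧ₙ x) (ℤₚ.abs-* (+ t) z)) ⟩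
  t ℕ.* ℤ.∣ z ∣ ℕ.* ↧ₙ x            ≡⟨ ℕₚ.*-assoc t ℤ.∣ z ∣ (↧ₙ x) ⟩
  t ℕ.* (ℤ.∣ z ∣ ℕ.* ↧ₙ x)          ∎
  where
  lem : ∀ a b x → a ⊗ (b ⊗ x) ≡ (a ⊗ x) ⊗ b
  lem = solve-∀ ℚ-ring
  cleared : ι (+ d ℤ.* ↥ x) ≡ ι (+ t ℤ.* z ℤ.* + ↧ₙ x)
  cleared = begin
    ι (+ d ℤ.* ↥ x)                ≡⟨ ι-* (+ d) (↥ x) ⟩
    ν d ⊗ ι (↥ x)                  ≡⟨ cong (ν d ⊗_) (sym (↧⊗ x)) ⟩
    ν d ⊗ (ν (↧ₙ x) ⊗ x)           ≡⟨ lem (ν d) (ν (↧ₙ x)) x ⟩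
    (ν d ⊗ x) ⊗ ν (↧ₙ x)           ≡⟨ cong (_⊗ ν (↧ₙ x)) eq ⟩
    ι (+ t ℤ.* z) ⊗ ν (↧ₙ x)       ≡⟨ sym (ι-* (+ t ℤ.* z) (+ ↧ₙ x)) ⟩
    ι (+ t ℤ.* z ℤ.* + ↧ₙ x)       ∎

coprime-↧-↥ : ∀ x → Coprime (↧ₙ x) ℤ.∣ ↥ x ∣
coprime-↧-↥ (ℚ.mkℚ _ _ c) = Cop.sym (Cop.recompute c)

lm⇒∣↥ : ∀ m k {x} → LocalMultiple m (m ℕ.^ k) x → m ℕ.^ k ∣ ℤ.∣ ↥ x ∣
lm⇒∣↥ m k {x} h = Cop.coprime-divisor (coprime-^ʳ k (LocalMultiple.coprime h))
  (∣-trans (m∣m*n (ℤ.∣ LocalMultiple.num h ∣ ℕ.* ↧ₙ x)) (∣-reflexive (sym (lm-numerator h))))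

-- The exponent has to be positive: it is because m divides the numerator that the reduced
-- denominator is prime to m.
∣↥⇒lm : ∀ m k x → m ℕ.^ suc k ∣ ℤ.∣ ↥ x ∣ → LocalMultiple m (m ℕ.^ suc k) x
∣↥⇒lm m k x t∣↥ = lm-cancel-unit (↧ₙ x) c
  (subst (LocalMultiple m (m ℕ.^ suc k)) (sym (↧⊗ x)) (lm-∣ (↥ x) t∣↥))
  where
  c : Coprime (↧ₙ x) m
  c (e∣↧ , e∣m) = coprime-↧-↥ x (e∣↧ , ∣-trans e∣m (∣-trans (m∣m*n (m ℕ.^ k)) t∣↥))
  lm-∣ : ∀ {t} i → t ∣ ℤ.∣ i ∣ → LocalMultiple m t (ι i)
  lm-∣ {t} i t∣i = lm-weaken t∣i (localMultiple 1 (ℤ.sign i ℤ.◃ 1) (Cop.1-coprimeTo m) (trans (cong (_⊗ ι i) ι-1)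
    (trans (ℚₚ.*-identityˡ (ι i)) (cong ι (begin
      i ≡⟨ sym (ℤₚ.◃-inverse i) ⟩
      ℤ.sign i ℤ.◃ ℤ.∣ i ∣ ≡⟨ cong (ℤ.sign i ℤ.◃_) (sym (ℕₚ.*-identityʳ ℤ.∣ i ∣)) ⟩
      ℤ.sign i ℤ.◃ (ℤ.∣ i ∣ ℕ.* 1) ≡⟨ ℤₚ.◃-distrib-* Sign.+ (ℤ.sign i) ℤ.∣ i ∣ 1 ⟩
      (Sign.+ ℤ.◃ ℤ.∣ i ∣) ℤ.* (ℤ.sign i ℤ.◃ 1) ≡⟨ cong (ℤ._* (ℤ.sign i ℤ.◃ 1)) (ℤₚ.+◃n≡+n ℤ.∣ i ∣) ⟩
      + ℤ.∣ i ∣ ℤ.* (ℤ.sign i ℤ.◃ 1) ∎)))))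

lm⇒coprime-↧ : ∀ {m x} → LocalMultiple m 1 x → Coprime (↧ₙ x) m
lm⇒coprime-↧ {x = x} h (e∣↧ , e∣m) = coprime (∣-trans e∣↧ ↧∣den , e∣m)
  where
  open LocalMultiple h
  ↧∣den : ↧ₙ x ∣ den
  ↧∣den = Cop.coprime-divisor (coprime-↧-↥ x)
    (divides ℤ.∣ num ∣ (trans (ℕₚ.*-comm ℤ.∣ ↥ x ∣ den) (trans (lm-numerator h) (ℕₚ.+-identityʳ _))))

coprime-↧⇒lm : ∀ {m} x → Coprime (↧ₙ x) m → LocalMultiple m 1 x
coprime-↧⇒lm x c = localMultiple (↧ₙ x) (↥ x) c (trans (↧⊗ x) (cong ι (sym (ℤₚ.*-identityˡ (↥ x)))))

-- A substitute for valuations at the primes dividing m: while g = gcd(N, m) is not 1, it is at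
-- least b, and dividing N by g costs one factor m. As N < b^(s+1), this happens at most s times,
-- and what is left of N is prime to m.
rough⇒clear : ∀ {b m} → b Rough m → ∀ s N .{{_ : ℕ.NonZero N}} → N ℕ.< b ℕ.^ suc s →
  ∃ λ d → Coprime d m × N ∣ d ℕ.* m ℕ.^ s
rough⇒clear {b} {m} rough s N N<b^ with gcd N m in g≡
... | 0 = contradiction g≡ (gcd[m,n]≢0 N m (inj₁ (ℕ.≢-nonZero⁻¹ N)))
... | 1 = N , Cop.gcd≡1⇒coprime g≡ , m∣m*n (m ℕ.^ s)
... | g@(suc (suc _)) with subst (_∣ N) g≡ (gcd[m,n]∣m N m)
...   | divides N′ refl = go s N<b^
  where
  g∣m : g ∣ m
  g∣m = subst (_∣ m) g≡ (gcd[m,n]∣n N m)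
  b≤g : b ℕ.≤ g
  b≤g = rough⇒≤ (rough∧∣⇒rough rough g∣m)
  instance
    N′≢0 : ℕ.NonZero N′
    N′≢0 = ℕₚ.m*n≢0⇒m≢0 N′
  go : ∀ s → N′ ℕ.* g ℕ.< b ℕ.^ suc s → ∃ λ d → Coprime d m × N′ ℕ.* g ∣ d ℕ.* m ℕ.^ s
  go zero    lt = contradiction (ℕₚ.<-≤-trans lt (ℕₚ.≤-trans (ℕₚ.≤-reflexive (ℕₚ.*-identityʳ b)) (ℕₚ.≤-trans b≤g (ℕₚ.m≤n*m g N′)))) (ℕₚ.<-irrefl refl)
  go (suc s) lt with rough⇒clear rough s N′ (ℕₚ.*-cancelʳ-< g N′ (b ℕ.^ suc s)
      (ℕₚ.<-≤-trans lt (ℕₚ.≤-trans (ℕₚ.≤-reflexive (ℕₚ.*-comm b (b ℕ.^ suc s))) (ℕₚ.*-monoʳ-≤ (b ℕ.^ suc s) b≤g))))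
  ... | d , c , N′∣ = d , c , ∣-trans (∣-trans (*-monoˡ-∣ g N′∣) (*-monoʳ-∣ (d ℕ.* m ℕ.^ s) g∣m))
      (∣-reflexive (lem d (m ℕ.^ s) m))
    where
    lem : ∀ d a m → d ℕ.* a ℕ.* m ≡ d ℕ.* (m ℕ.* a)
    lem = ℕ-solve-∀

-- Of the c + s factors m, s are spent on clearing the denominator N and c are kept.
lm-fraction : ∀ {b m} → b Rough m → ∀ c s N .{{_ : ℕ.NonZero N}} → N ℕ.< b ℕ.^ suc s →
  LocalMultiple m (m ℕ.^ c) (+ (m ℕ.^ (c ℕ.+ s)) / N)
lm-fraction {b} {m} rough c s N N<b^ with rough⇒clear rough s N N<b^
... | d , cop , divides q eq = localMultiple d (+ q) cop (⊗-cancel-ν N (begin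
  ν N ⊗ (ν d ⊗ x)                      ≡⟨ lem (ν N) (ν d) x ⟩
  ν d ⊗ (ν N ⊗ x)                      ≡⟨ cong (ν d ⊗_) (⊗-/ (+ (m ℕ.^ (c ℕ.+ s))) N) ⟩
  ν d ⊗ ν (m ℕ.^ (c ℕ.+ s))            ≡⟨ sym (ν-* d (m ℕ.^ (c ℕ.+ s))) ⟩
  ν (d ℕ.* m ℕ.^ (c ℕ.+ s))            ≡⟨ cong ν ℕ-eq ⟩
  ν (N ℕ.* (m ℕ.^ c ℕ.* q))            ≡⟨ ν-* N (m ℕ.^ c ℕ.* q) ⟩
  ν N ⊗ ν (m ℕ.^ c ℕ.* q)              ≡⟨ cong (λ i → ν N ⊗ ι i) (ℤₚ.pos-* (m ℕ.^ c) q) ⟩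
  ν N ⊗ ι (+ (m ℕ.^ c) ℤ.* + q)        ∎))
  where
  x : ℚ
  x = + (m ℕ.^ (c ℕ.+ s)) / N
  lem : ∀ a b x → a ⊗ (b ⊗ x) ≡ b ⊗ (a ⊗ x)
  lem = solve-∀ ℚ-ring
  lem₁ : ∀ d a b → d ℕ.* (a ℕ.* b) ≡ a ℕ.* (d ℕ.* b)
  lem₁ = ℕ-solve-∀
  lem₂ : ∀ a q N → a ℕ.* (q ℕ.* N) ≡ N ℕ.* (a ℕ.* q)
  lem₂ = ℕ-solve-∀
  ℕ-eq : d ℕ.* m ℕ.^ (c ℕ.+ s) ≡ N ℕ.* (m ℕ.^ c ℕ.* q)
  ℕ-eq = begin
    d ℕ.* m ℕ.^ (c ℕ.+ s)          ≡⟨ cong (d ℕ.*_) (ℕₚ.^-distribˡ-+-* m c s) ⟩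
    d ℕ.* (m ℕ.^ c ℕ.* m ℕ.^ s)    ≡⟨ lem₁ d (m ℕ.^ c) (m ℕ.^ s) ⟩
    m ℕ.^ c ℕ.* (d ℕ.* m ℕ.^ s)    ≡⟨ cong (m ℕ.^ c ℕ.*_) eq ⟩
    m ℕ.^ c ℕ.* (q ℕ.* N)          ≡⟨ lem₂ (m ℕ.^ c) q N ⟩
    N ℕ.* (m ℕ.^ c ℕ.* q)          ∎

-- The higher terms of Faulhaber's formula

faulhaberTerm : ℕ → ℕ → Series
faulhaberTerm m n k = ν (n C k) ⊗ (expQuot m k ⊗ bernoulli (n ℕ.∸ k))

faulhaberTail : ℕ → ℕ → ℚ
faulhaberTail m n = ∑ n (λ k → faulhaberTerm m n (suc k))

powerSum-split : ∀ m n → ν (powerSum n m) ≡ ν m ⊗ bernoulli n ⊕ faulhaberTail m n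
powerSum-split m n = begin
  ν (powerSum n m)                                     ≡⟨ faulhaber m n ⟩
  (expQuot m ⋆ bernoulli) n                            ≡⟨ ⋆-∑ (expQuot m) bernoulli n ⟩
  ν 1 ⊗ (expQuot m 0 ⊗ bernoulli n) ⊕ faulhaberTail m n ≡⟨ cong (_⊕ faulhaberTail m n) (begin
    ν 1 ⊗ (expQuot m 0 ⊗ bernoulli n)  ≡⟨ cong (_⊗ (expQuot m 0 ⊗ bernoulli n)) ι-1 ⟩
    1ℚ ⊗ (expQuot m 0 ⊗ bernoulli n)   ≡⟨ ℚₚ.*-identityˡ (expQuot m 0 ⊗ bernoulli n) ⟩
    expQuot m 0 ⊗ bernoulli n          ≡⟨ cong (_⊗ bernoulli n) (trans (sym (ι-def (+ (m ℕ.* 1)))) (cong ν (ℕₚ.*-identityʳ m))) ⟩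
    ν m ⊗ bernoulli n                  ∎) ⟩
  ν m ⊗ bernoulli n ⊕ faulhaberTail m n                ∎

expQuot-scale : ∀ m k → expQuot m k ≡ ν m ⊗ (+ (m ℕ.^ k) / suc k)
expQuot-scale m k = ⊗-cancel-ν (suc k) (begin
  ν (suc k) ⊗ expQuot m k                       ≡⟨ ⊗-/ (+ (m ℕ.^ suc k)) (suc k) ⟩
  ν (m ℕ.* m ℕ.^ k)                             ≡⟨ ν-* m (m ℕ.^ k) ⟩
  ν m ⊗ ν (m ℕ.^ k)                             ≡⟨ cong (ν m ⊗_) (sym (⊗-/ (+ (m ℕ.^ k)) (suc k))) ⟩
  ν m ⊗ (ν (suc k) ⊗ (+ (m ℕ.^ k) / suc k))     ≡⟨ lem (ν m) (ν (suc k)) (+ (m ℕ.^ k) / suc k) ⟩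
  ν (suc k) ⊗ (ν m ⊗ (+ (m ℕ.^ k) / suc k))     ∎)
  where
  lem : ∀ a b x → a ⊗ (b ⊗ x) ≡ b ⊗ (a ⊗ x)
  lem = solve-∀ ℚ-ring

-- With k = c + s, the term has k + 1 factors m: one makes Bₙ₋ₖ integral, s clear the denominator k
-- + 1, and c remain. Integrality of m Bₙ₋ₖ is a hypothesis so that the lemma can serve inside the
-- induction that proves it.
lm-term-step : ∀ {b m} → b Rough m → ∀ c s n → suc (c ℕ.+ s) ℕ.< b ℕ.^ suc s →
  LocalMultiple m 1 (ν m ⊗ bernoulli (n ℕ.∸ (c ℕ.+ s))) → LocalMultiple m (m ℕ.^ c) (faulhaberTerm m n (c ℕ.+ s))
lm-term-step {b} {m} rough c s n lt integral = lm-scale (+ (n C k))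
  (subst₂ (LocalMultiple m) (ℕₚ.*-identityʳ (m ℕ.^ c)) (begin
    (+ (m ℕ.^ k) / suc k) ⊗ (ν m ⊗ bernoulli (n ℕ.∸ k))
      ≡⟨ lem (+ (m ℕ.^ k) / suc k) (ν m) (bernoulli (n ℕ.∸ k)) ⟩
    (ν m ⊗ (+ (m ℕ.^ k) / suc k)) ⊗ bernoulli (n ℕ.∸ k)
      ≡⟨ cong (_⊗ bernoulli (n ℕ.∸ k)) (sym (expQuot-scale m k)) ⟩
    expQuot m k ⊗ bernoulli (n ℕ.∸ k) ∎)
    (lm-* (lm-fraction rough c s (suc k) lt) integral))
  where
  k = c ℕ.+ s
  lem : ∀ a b x → a ⊗ (b ⊗ x) ≡ (b ⊗ a) ⊗ x
  lem = solve-∀ ℚ-ring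

1+s<2^1+s : ∀ s → suc s ℕ.< 2 ℕ.^ suc s
1+s<2^1+s zero    = ℕₚ.≤-refl
1+s<2^1+s (suc s) = ℕₚ.≤-trans (s≤s (1+s<2^1+s s))
  (ℕₚ.≤-trans (ℕₚ.+-monoˡ-≤ (2 ℕ.^ suc s) (ℕₚ.m^n>0 2 (suc s)))
    (ℕₚ.≤-reflexive (cong (2 ℕ.^ suc s ℕ.+_) (sym (ℕₚ.+-identityʳ (2 ℕ.^ suc s))))))

-- The size condition k + 1 < 2ᵏ for keeping one factor m when m is arbitrary, with k = s + 2. It
-- fails at k = 1, so that term has to be treated through the evenness of n.
3+s<2^2+s : ∀ s → 3 ℕ.+ s ℕ.< 2 ℕ.^ (2 ℕ.+ s)
3+s<2^2+s zero    = ℕₚ.≤-refl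
3+s<2^2+s (suc s) = ℕₚ.≤-trans (s≤s (3+s<2^2+s s))
  (ℕₚ.≤-trans (ℕₚ.+-monoˡ-≤ (2 ℕ.^ (2 ℕ.+ s)) (ℕₚ.m^n>0 2 (2 ℕ.+ s)))
    (ℕₚ.≤-reflexive (cong (2 ℕ.^ (2 ℕ.+ s) ℕ.+_) (sym (ℕₚ.+-identityʳ (2 ℕ.^ (2 ℕ.+ s)))))))

-- The size condition for keeping three factors m, with k = s + 3. The first case, denominator 4, is
-- the origin of the bound 5; being 5-rough amounts to being prime to 6.
4+s<5^1+s : ∀ s → 4 ℕ.+ s ℕ.< 5 ℕ.^ suc s
4+s<5^1+s zero    = ℕₚ.≤-refl
4+s<5^1+s (suc s) = ℕₚ.≤-trans (s≤s (4+s<5^1+s s))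
  (ℕₚ.≤-trans (ℕₚ.+-monoˡ-≤ (5 ℕ.^ suc s) (ℕₚ.m^n>0 5 (suc s)))
    (ℕₚ.+-monoʳ-≤ (5 ℕ.^ suc s) (ℕₚ.m≤m+n (5 ℕ.^ suc s) _)))

-- The part of von Staudt–Clausen needed here: m Bₙ is m-integral.
bernoulli-integral : ∀ m n → LocalMultiple m 1 (ν m ⊗ bernoulli n)
bernoulli-integral m = <-rec _ λ n rec → lm-cancel-+ʳ
  (subst (LocalMultiple m 1) (powerSum-split m n) (lm-ι (+ powerSum n m)))
  -- Faulhaber's formula is solved for m Bₙ: the term of index k + 1 contains m Bₙ₋ₖ₋₁, which is
  -- integral by induction, and its other factors m clear the denominator for every m.
  (lm-∑ n λ k k<n → lm-term-step 2-rough 0 (suc k) n (1+s<2^1+s (suc k))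
    (rec (ℕₚ.∸-monoʳ-< (s≤s z≤n) k<n)))

lm-term : ∀ {b m} → b Rough m → ∀ c s n → suc (c ℕ.+ s) ℕ.< b ℕ.^ suc s →
  LocalMultiple m (m ℕ.^ c) (faulhaberTerm m n (c ℕ.+ s))
lm-term {m = m} rough c s n lt = lm-term-step rough c s n lt (bernoulli-integral m (n ℕ.∸ (c ℕ.+ s)))

-- The factor n = 2q cancels the denominator 2, which for even m would cost a factor m.
faulhaberTerm-1 : ∀ m n q → n ≡ q ℕ.* 2 →
  faulhaberTerm m n 1 ≡ ν q ⊗ (ν m ⊗ (ν m ⊗ bernoulli (n ℕ.∸ 1)))
faulhaberTerm-1 m n q n≡2q = begin
  ν (n C 1) ⊗ ((+ (m ℕ.^ 2) / 2) ⊗ b)        ≡⟨ cong (λ c → ν c ⊗ ((+ (m ℕ.^ 2) / 2) ⊗ b)) (trans (Comb.nC1≡n n) n≡2q) ⟩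
  ν (q ℕ.* 2) ⊗ ((+ (m ℕ.^ 2) / 2) ⊗ b)      ≡⟨ cong (_⊗ ((+ (m ℕ.^ 2) / 2) ⊗ b)) (ν-* q 2) ⟩
  (ν q ⊗ ν 2) ⊗ ((+ (m ℕ.^ 2) / 2) ⊗ b)      ≡⟨ lem (ν q) (ν 2) (+ (m ℕ.^ 2) / 2) b ⟩
  ν q ⊗ ((ν 2 ⊗ (+ (m ℕ.^ 2) / 2)) ⊗ b)      ≡⟨ cong (λ x → ν q ⊗ (x ⊗ b)) (trans (⊗-/ (+ (m ℕ.^ 2)) 2) (trans (cong (λ x → ν (m ℕ.* x)) (ℕₚ.*-identityʳ m)) (ν-* m m))) ⟩
  ν q ⊗ ((ν m ⊗ ν m) ⊗ b)                    ≡⟨ cong (ν q ⊗_) (ℚₚ.*-assoc (ν m) (ν m) b) ⟩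
  ν q ⊗ (ν m ⊗ (ν m ⊗ b))                    ∎
  where
  b : ℚ
  b = bernoulli (n ℕ.∸ 1)
  lem : ∀ q t x b → (q ⊗ t) ⊗ (x ⊗ b) ≡ q ⊗ ((t ⊗ x) ⊗ b)
  lem = solve-∀ ℚ-ring

tail-mod-m : ∀ m n → 2 ∣ n → LocalMultiple m m (faulhaberTail m n)
tail-mod-m m zero    _ = lm-0
tail-mod-m m (suc l) (divides q n≡) = lm-+
  (subst (LocalMultiple m m) (sym (faulhaberTerm-1 m (suc l) q n≡))
    (lm-scale (+ q) (lm-ν* (bernoulli-integral m l))))
  (lm-∑ l λ k _ → subst (λ t → LocalMultiple m t (faulhaberTerm m (suc l) (2 ℕ.+ k))) (ℕₚ.*-identityʳ m)
    (lm-term 2-rough 1 (suc k) (suc l) (3+s<2^2+s k)))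

terms≥3-mod-m³ : ∀ {m} → 5 Rough m → ∀ n l → LocalMultiple m (m ℕ.^ 3) (∑ l (λ k → faulhaberTerm m n (3 ℕ.+ k)))
terms≥3-mod-m³ {m} rough n l = lm-∑ l λ k _ → lm-term rough 3 k n (4+s<5^1+s k)

rough⇒coprime : ∀ {b m u} .{{_ : ℕ.NonZero u}} → b Rough m → u ℕ.< b → Coprime u m
rough⇒coprime rough u<b {0} (0∣u , _) = contradiction (Div.0∣⇒≡0 0∣u) (ℕ.≢-nonZero⁻¹ _)
rough⇒coprime rough u<b {1} _ = refl
rough⇒coprime {b} {m} {u} rough u<b {suc (suc e)} (e∣u , e∣m) = contradiction
  (ℕₚ.<-≤-trans u<b (ℕₚ.≤-trans (rough⇒≤ (rough∧∣⇒rough rough e∣m)) (Div.∣⇒≤ e∣u)))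
  (ℕₚ.<-irrefl refl)

bernoulli-1-integral : ∀ {m} → 5 Rough m → LocalMultiple m 1 (bernoulli 1)
bernoulli-1-integral rough = localMultiple 2 ℤ.-1ℤ (rough⇒coprime rough (s≤s (s≤s (s≤s z≤n))))
  (trans (cong (_⊗ bernoulli 1) (ι-def (+ 2))) (sym (ι-def (+ 1 ℤ.* ℤ.-1ℤ))))

odd-bernoulli-integral : ∀ {m} → 5 Rough m → ∀ q → LocalMultiple m 1 (bernoulli (suc (q ℕ.* 2)))
odd-bernoulli-integral rough zero    = bernoulli-1-integral rough
odd-bernoulli-integral {m} rough (suc j) = subst (LocalMultiple m 1) (sym (bernoulli-odd j)) lm-0

tail-mod-m² : ∀ {m} → 5 Rough m → ∀ q → LocalMultiple m (m ℕ.^ 2) (faulhaberTail m (suc q ℕ.* 2))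
tail-mod-m² {m} rough q = lm-+
  (subst (LocalMultiple m (m ℕ.^ 2)) (sym (faulhaberTerm-1 m n (suc q) refl))
    (lm-scale (+ suc q) (lm-* {y = ν m ⊗ bernoulli (suc (q ℕ.* 2))} lm-ν (lm-* {y = bernoulli (suc (q ℕ.* 2))} lm-ν (odd-bernoulli-integral rough q)))))
  (lm-+ (lm-term rough 2 0 n (s≤s (s≤s (s≤s (s≤s z≤n)))))
    (lm-weaken (divides m refl) (terms≥3-mod-m³ rough n (q ℕ.* 2))))
  where n = suc q ℕ.* 2

2*[1+n]C2 : ∀ n → 2 ℕ.* (suc n C 2) ≡ n ℕ.* suc n
2*[1+n]C2 zero    = refl
2*[1+n]C2 (suc n) = begin
  2 ℕ.* (suc (suc n) C 2)                 ≡⟨ cong (2 ℕ.*_) (sym (Comb.nCk+nC[k+1]≡[n+1]C[k+1] (suc n) 1)) ⟩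
  2 ℕ.* (suc n C 1 ℕ.+ suc n C 2)         ≡⟨ ℕₚ.*-distribˡ-+ 2 (suc n C 1) (suc n C 2) ⟩
  2 ℕ.* (suc n C 1) ℕ.+ 2 ℕ.* (suc n C 2) ≡⟨ cong₂ (λ x y → 2 ℕ.* x ℕ.+ y) (Comb.nC1≡n (suc n)) (2*[1+n]C2 n) ⟩
  2 ℕ.* suc n ℕ.+ n ℕ.* suc n             ≡⟨ lem n ⟩
  suc n ℕ.* suc (suc n)                   ∎
  where
  lem : ∀ n → 2 ℕ.* (1 ℕ.+ n) ℕ.+ n ℕ.* (1 ℕ.+ n) ≡ (1 ℕ.+ n) ℕ.* (2 ℕ.+ n)
  lem = ℕ-solve-∀

-- Here n = l + 2 is at least 4, so Bₙ₋₁ = 0 removes the term k = 1. In the term k = 2, namely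
-- (m³/3) C(n,2) Bₙ₋₂, both 3 and 2 are units at m and 2 C(n,2) = (n - 1) n, whence the hypothesis
-- on n Bₙ₋₂.
tail-mod-m³ : ∀ {m} → 5 Rough m → ∀ j → let l = suc j ℕ.* 2 in
  LocalMultiple m 1 (ν (2 ℕ.+ l) ⊗ bernoulli l) → LocalMultiple m (m ℕ.^ 3) (faulhaberTail m (2 ℕ.+ l))
tail-mod-m³ {m} rough j integral = lm-+
  (subst (LocalMultiple m (m ℕ.^ 3)) (sym first≡0) lm-0)
  (lm-+ (subst₂ (LocalMultiple m) (ℕₚ.*-identityʳ (m ℕ.^ 3)) (lem (expQuot m 2) (ν (n C 2)) (bernoulli l))
      (lm-* (lm-fraction rough 3 0 3 (s≤s (s≤s (s≤s (s≤s z≤n))))) binomial-integral))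
    (terms≥3-mod-m³ rough n l))
  where
  l = suc j ℕ.* 2
  n = 2 ℕ.+ l
  lem : ∀ x c b → x ⊗ (c ⊗ b) ≡ c ⊗ (x ⊗ b)
  lem = solve-∀ ℚ-ring
  first≡0 : faulhaberTerm m n 1 ≡ 0ℚ
  first≡0 = begin
    ν (n C 1) ⊗ (expQuot m 1 ⊗ bernoulli (suc l)) ≡⟨ cong (λ b → ν (n C 1) ⊗ (expQuot m 1 ⊗ b)) (bernoulli-odd j) ⟩
    ν (n C 1) ⊗ (expQuot m 1 ⊗ 0ℚ)                ≡⟨ cong (ν (n C 1) ⊗_) (ℚₚ.*-zeroʳ (expQuot m 1)) ⟩
    ν (n C 1) ⊗ 0ℚ                                ≡⟨ ℚₚ.*-zeroʳ (ν (n C 1)) ⟩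
    0ℚ                                            ∎
  binomial-integral : LocalMultiple m 1 (ν (n C 2) ⊗ bernoulli l)
  binomial-integral = lm-cancel-unit 2 (rough⇒coprime rough (s≤s (s≤s (s≤s z≤n))))
    (subst (LocalMultiple m 1) (begin
      ν (suc l) ⊗ (ν n ⊗ bernoulli l)   ≡⟨ sym (ℚₚ.*-assoc (ν (suc l)) (ν n) (bernoulli l)) ⟩
      ν (suc l) ⊗ ν n ⊗ bernoulli l     ≡⟨ cong (_⊗ bernoulli l) (sym (ν-* (suc l) n)) ⟩
      ν (suc l ℕ.* n) ⊗ bernoulli l     ≡⟨ cong (λ c → ν c ⊗ bernoulli l) (sym (2*[1+n]C2 (suc l))) ⟩
      ν (2 ℕ.* (n C 2)) ⊗ bernoulli l   ≡⟨ cong (_⊗ bernoulli l) (ν-* 2 (n C 2)) ⟩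
      ν 2 ⊗ ν (n C 2) ⊗ bernoulli l     ≡⟨ ℚₚ.*-assoc (ν 2) (ν (n C 2)) (bernoulli l) ⟩
      ν 2 ⊗ (ν (n C 2) ⊗ bernoulli l)   ∎)
    (lm-scale (+ suc l) integral))

-- Power sums modulo p²

∑ℕ : ℕ → (ℕ → ℕ) → ℕ
∑ℕ zero    f = 0
∑ℕ (suc n) f = ∑ℕ n f ℕ.+ f n

powerSum≡∑ℕ : ∀ n m → powerSum n m ≡ ∑ℕ m (ℕ._^ n)
powerSum≡∑ℕ n zero    = refl
powerSum≡∑ℕ n (suc m) = trans (powerSum-suc n m) (cong (ℕ._+ m ℕ.^ n) (powerSum≡∑ℕ n m))

∑ℕ-cong : ∀ n {f g} → (∀ j → f j ≡ g j) → ∑ℕ n f ≡ ∑ℕ n g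
∑ℕ-cong zero    eq = refl
∑ℕ-cong (suc n) eq = cong₂ ℕ._+_ (∑ℕ-cong n eq) (eq n)

∑ℕ-+ : ∀ n f g → ∑ℕ n (λ j → f j ℕ.+ g j) ≡ ∑ℕ n f ℕ.+ ∑ℕ n g
∑ℕ-+ zero    f g = refl
∑ℕ-+ (suc n) f g = trans (cong (ℕ._+ (f n ℕ.+ g n)) (∑ℕ-+ n f g)) (lem (∑ℕ n f) (∑ℕ n g) (f n) (g n))
  where
  lem : ∀ a b c d → a ℕ.+ b ℕ.+ (c ℕ.+ d) ≡ a ℕ.+ c ℕ.+ (b ℕ.+ d)
  lem = ℕ-solve-∀

∑ℕ-* : ∀ n c f → ∑ℕ n (λ j → c ℕ.* f j) ≡ c ℕ.* ∑ℕ n f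
∑ℕ-* zero    c f = sym (ℕₚ.*-zeroʳ c)
∑ℕ-* (suc n) c f = trans (cong (ℕ._+ c ℕ.* f n) (∑ℕ-* n c f)) (sym (ℕₚ.*-distribˡ-+ c (∑ℕ n f) (f n)))

-- Congruences mod d are carried as f = g + d q with a natural number q; in every use f exceeds its
-- reduction g, so everything stays in ℕ.
∑ℕ-≡+multiple : ∀ n d {f g} → (∀ j → j ℕ.< n → ∃ λ q → f j ≡ g j ℕ.+ d ℕ.* q) →
  ∃ λ q → ∑ℕ n f ≡ ∑ℕ n g ℕ.+ d ℕ.* q
∑ℕ-≡+multiple zero    d h = 0 , sym (ℕₚ.*-zeroʳ d)
∑ℕ-≡+multiple (suc n) d {f} {g} h with ∑ℕ-≡+multiple n d (λ j j<n → h j (ℕₚ.m<n⇒m<1+n j<n)) | h n (ℕₚ.n<1+n n)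
... | Q , eq | q , eq′ = Q ℕ.+ q , trans (cong₂ ℕ._+_ eq eq′) (lem (∑ℕ n g) (g n) d Q q)
  where
  lem : ∀ a b d Q q → a ℕ.+ d ℕ.* Q ℕ.+ (b ℕ.+ d ℕ.* q) ≡ a ℕ.+ b ℕ.+ d ℕ.* (Q ℕ.+ q)
  lem = ℕ-solve-∀

∑ℕ-split : ∀ a b f → ∑ℕ (a ℕ.+ b) f ≡ ∑ℕ a f ℕ.+ ∑ℕ b (λ j → f (a ℕ.+ j))
∑ℕ-split a zero    f = trans (cong (λ n → ∑ℕ n f) (ℕₚ.+-identityʳ a)) (sym (ℕₚ.+-identityʳ (∑ℕ a f)))
∑ℕ-split a (suc b) f = begin
  ∑ℕ (a ℕ.+ suc b) f                                                ≡⟨ cong (λ n → ∑ℕ n f) (ℕₚ.+-suc a b) ⟩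
  ∑ℕ (a ℕ.+ b) f ℕ.+ f (a ℕ.+ b)                                    ≡⟨ cong (ℕ._+ f (a ℕ.+ b)) (∑ℕ-split a b f) ⟩
  ∑ℕ a f ℕ.+ ∑ℕ b (λ j → f (a ℕ.+ j)) ℕ.+ f (a ℕ.+ b)               ≡⟨ ℕₚ.+-assoc (∑ℕ a f) _ _ ⟩
  ∑ℕ a f ℕ.+ (∑ℕ b (λ j → f (a ℕ.+ j)) ℕ.+ f (a ℕ.+ b))             ∎

∑ℕ-even-odd : ∀ h f → ∑ℕ (suc (h ℕ.* 2)) f ≡ ∑ℕ (suc h) (λ j → f (2 ℕ.* j)) ℕ.+ ∑ℕ h (λ j → f (1 ℕ.+ 2 ℕ.* j))
∑ℕ-even-odd zero    f = sym (ℕₚ.+-identityʳ (f 0))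
∑ℕ-even-odd (suc h) f = begin
  ∑ℕ (suc (h ℕ.* 2)) f ℕ.+ f (1 ℕ.+ h ℕ.* 2) ℕ.+ f (2 ℕ.+ h ℕ.* 2)
    ≡⟨ cong (λ s → s ℕ.+ f (1 ℕ.+ h ℕ.* 2) ℕ.+ f (2 ℕ.+ h ℕ.* 2)) (∑ℕ-even-odd h f) ⟩
  E ℕ.+ O ℕ.+ f (1 ℕ.+ h ℕ.* 2) ℕ.+ f (2 ℕ.+ h ℕ.* 2)
    ≡⟨ cong₂ (λ x y → E ℕ.+ O ℕ.+ f x ℕ.+ f y) (lem₁ h) (lem₂ h) ⟩
  E ℕ.+ O ℕ.+ f (1 ℕ.+ 2 ℕ.* h) ℕ.+ f (2 ℕ.* suc h)
    ≡⟨ lem E O (f (1 ℕ.+ 2 ℕ.* h)) (f (2 ℕ.* suc h)) ⟩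
  E ℕ.+ f (2 ℕ.* suc h) ℕ.+ (O ℕ.+ f (1 ℕ.+ 2 ℕ.* h)) ∎
  where
  E = ∑ℕ (suc h) (λ j → f (2 ℕ.* j))
  O = ∑ℕ h (λ j → f (1 ℕ.+ 2 ℕ.* j))
  lem : ∀ a b c d → a ℕ.+ b ℕ.+ c ℕ.+ d ≡ a ℕ.+ d ℕ.+ (b ℕ.+ c)
  lem = ℕ-solve-∀
  lem₁ : ∀ h → 1 ℕ.+ h ℕ.* 2 ≡ 1 ℕ.+ 2 ℕ.* h
  lem₁ = ℕ-solve-∀
  lem₂ : ∀ h → 2 ℕ.+ h ℕ.* 2 ≡ 2 ℕ.* (1 ℕ.+ h)
  lem₂ = ℕ-solve-∀

∑ℕ-odd : ∀ h → ∑ℕ h (λ j → 1 ℕ.+ 2 ℕ.* j) ≡ h ℕ.* h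
∑ℕ-odd zero    = refl
∑ℕ-odd (suc h) = trans (cong (ℕ._+ (1 ℕ.+ 2 ℕ.* h)) (∑ℕ-odd h)) (lem h)
  where
  lem : ∀ h → h ℕ.* h ℕ.+ (1 ℕ.+ 2 ℕ.* h) ≡ (1 ℕ.+ h) ℕ.* (1 ℕ.+ h)
  lem = ℕ-solve-∀

-- Passage to sums over `Fin n`, which are invariant under permutations.
∑ℕ≡sum : ∀ n f → ∑ℕ n f ≡ sumFin {n} (f ∘ Fin.toℕ)
∑ℕ≡sum zero    f = refl
∑ℕ≡sum (suc n) f = sym (begin
  sumFin {suc n} (f ∘ Fin.toℕ)
    ≡⟨ sum-init-last (f ∘ Fin.toℕ) ⟩
  sumFin {n} (f ∘ Fin.toℕ ∘ Fin.inject₁) ℕ.+ f (Fin.toℕ (Fin.fromℕ n))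
    ≡⟨ cong₂ ℕ._+_ (sum-cong-≗ {n} (λ i → cong f (Finₚ.toℕ-inject₁ i))) (cong f (Finₚ.toℕ-fromℕ n)) ⟩
  sumFin {n} (f ∘ Fin.toℕ) ℕ.+ f n
    ≡⟨ cong (ℕ._+ f n) (sym (∑ℕ≡sum n f)) ⟩
  ∑ℕ n f ℕ.+ f n ∎)

module _ (p : ℕ) .{{_ : ℕ.NonZero p}} where

  coprime⇒inverse : ∀ {a} → Coprime a p → ∃ λ b → (a ℕ.* b) % p ≡ 1 % p
  coprime⇒inverse {a} c with Cop.coprime-Bézout c
  ... | Bézout.+- x y eq = x , (begin
    (a ℕ.* x) % p       ≡⟨ cong (_% p) (trans (ℕₚ.*-comm a x) (sym eq)) ⟩
    (1 ℕ.+ y ℕ.* p) % p ≡⟨ [m+kn]%n≡m%n 1 y p ⟩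
    1 % p               ∎)
  -- In this case 1 + x a = y p, so -x is the inverse; x (p - 1) represents it in ℕ.
  ... | Bézout.-+ x y eq = x ℕ.* ℕ.pred p , (begin
    (a ℕ.* (x ℕ.* ℕ.pred p)) % p                    ≡⟨ sym ([m+kn]%n≡m%n (a ℕ.* (x ℕ.* ℕ.pred p)) y p) ⟩
    (a ℕ.* (x ℕ.* ℕ.pred p) ℕ.+ y ℕ.* p) % p        ≡⟨ cong (λ u → (a ℕ.* (x ℕ.* ℕ.pred p) ℕ.+ u) % p) (sym eq) ⟩
    (a ℕ.* (x ℕ.* ℕ.pred p) ℕ.+ (1 ℕ.+ x ℕ.* a)) % p ≡⟨ cong (_% p) (lem a x (ℕ.pred p)) ⟩
    (1 ℕ.+ (x ℕ.* a) ℕ.* suc (ℕ.pred p)) % p        ≡⟨ cong (λ u → (1 ℕ.+ (x ℕ.* a) ℕ.* u) % p) (ℕₚ.suc-pred p) ⟩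
    (1 ℕ.+ (x ℕ.* a) ℕ.* p) % p                     ≡⟨ [m+kn]%n≡m%n 1 (x ℕ.* a) p ⟩
    1 % p                                           ∎)
    where
    lem : ∀ a x k → a ℕ.* (x ℕ.* k) ℕ.+ (1 ℕ.+ x ℕ.* a) ≡ 1 ℕ.+ (x ℕ.* a) ℕ.* (1 ℕ.+ k)
    lem = ℕ-solve-∀

  *-% : ℕ → Fin p → Fin p
  *-% a i = Fin.fromℕ< (m%n<n (a ℕ.* Fin.toℕ i) p)

  *-%-inverse : ∀ a b → (a ℕ.* b) % p ≡ 1 % p → ∀ i → *-% a (*-% b i) ≡ i
  *-%-inverse a b ab≡1 i = Finₚ.toℕ-injective (begin
    Fin.toℕ (*-% a (*-% b i))            ≡⟨ Finₚ.toℕ-fromℕ< _ ⟩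
    (a ℕ.* Fin.toℕ (*-% b i)) % p        ≡⟨ cong (λ u → (a ℕ.* u) % p) (Finₚ.toℕ-fromℕ< _) ⟩
    (a ℕ.* ((b ℕ.* k) % p)) % p          ≡⟨ %-distribˡ-* a ((b ℕ.* k) % p) p ⟩
    ((a % p) ℕ.* ((b ℕ.* k) % p % p)) % p ≡⟨ cong (λ u → ((a % p) ℕ.* u) % p) (m%n%n≡m%n (b ℕ.* k) p) ⟩
    ((a % p) ℕ.* ((b ℕ.* k) % p)) % p    ≡⟨ sym (%-distribˡ-* a (b ℕ.* k) p) ⟩
    (a ℕ.* (b ℕ.* k)) % p                ≡⟨ cong (_% p) (sym (ℕₚ.*-assoc a b k)) ⟩
    (a ℕ.* b ℕ.* k) % p                  ≡⟨ %-distribˡ-* (a ℕ.* b) k p ⟩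
    ((a ℕ.* b) % p ℕ.* (k % p)) % p      ≡⟨ cong (λ u → (u ℕ.* (k % p)) % p) ab≡1 ⟩
    (1 % p ℕ.* (k % p)) % p              ≡⟨ sym (%-distribˡ-* 1 k p) ⟩
    (1 ℕ.* k) % p                        ≡⟨ cong (_% p) (ℕₚ.*-identityˡ k) ⟩
    k % p                                ≡⟨ m<n⇒m%n≡m (Finₚ.toℕ<n i) ⟩
    k                                    ∎)
    where k = Fin.toℕ i

  ∑ℕ-*-% : ∀ {a} → Coprime a p → ∀ f → ∑ℕ p (λ j → f ((a ℕ.* j) % p)) ≡ ∑ℕ p f
  ∑ℕ-*-% {a} c f with coprime⇒inverse c
  ... | b , ab≡1 = begin
    ∑ℕ p (λ j → f ((a ℕ.* j) % p))            ≡⟨ ∑ℕ≡sum p _ ⟩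
    sumFin {p} (λ i → f ((a ℕ.* Fin.toℕ i) % p)) ≡⟨ sum-cong-≗ {p} (λ i → cong f (sym (Finₚ.toℕ-fromℕ< _))) ⟩
    sumFin {p} (λ i → f (Fin.toℕ (*-% a i)))     ≡⟨ sym (sum-permute (f ∘ Fin.toℕ) π) ⟩
    sumFin {p} (f ∘ Fin.toℕ)                     ≡⟨ sym (∑ℕ≡sum p f) ⟩
    ∑ℕ p f                                    ∎
    where
    π : Permutation′ p
    π = permutation (*-% a) (*-% b) (*-%-inverse a b ab≡1) (*-%-inverse b a (trans (cong (_% p) (ℕₚ.*-comm b a)) ab≡1))

-- Taylor expansion to first order; for y = p the remainder is a multiple of p², the precision of
-- Voronoi's congruence.
^-expand : ∀ k x y → ∃ λ q → (x ℕ.+ y) ℕ.^ suc k ≡ x ℕ.^ suc k ℕ.+ suc k ℕ.* x ℕ.^ k ℕ.* y ℕ.+ y ℕ.* y ℕ.* q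
^-expand zero    x y = 0 , lem x y
  where
  lem : ∀ x y → (x ℕ.+ y) ℕ.* 1 ≡ x ℕ.* 1 ℕ.+ 1 ℕ.* 1 ℕ.* y ℕ.+ y ℕ.* y ℕ.* 0
  lem = ℕ-solve-∀
^-expand (suc k) x y with ^-expand k x y
... | q , eq = (1 ℕ.+ k) ℕ.* x ℕ.^ k ℕ.+ (x ℕ.+ y) ℕ.* q , trans (cong ((x ℕ.+ y) ℕ.*_) eq) (lem x y (x ℕ.^ k) k q)
  where
  lem : ∀ x y e k q → (x ℕ.+ y) ℕ.* (x ℕ.* e ℕ.+ (1 ℕ.+ k) ℕ.* e ℕ.* y ℕ.+ y ℕ.* y ℕ.* q) ≡
    x ℕ.* (x ℕ.* e) ℕ.+ (2 ℕ.+ k) ℕ.* (x ℕ.* e) ℕ.* y ℕ.+ y ℕ.* y ℕ.* ((1 ℕ.+ k) ℕ.* e ℕ.+ (x ℕ.+ y) ℕ.* q)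
  lem = ℕ-solve-∀

^-≡+multiple : ∀ k x d z → ∃ λ q → (x ℕ.+ d ℕ.* z) ℕ.^ k ≡ x ℕ.^ k ℕ.+ d ℕ.* q
^-≡+multiple zero    x d z = 0 , cong suc (sym (ℕₚ.*-zeroʳ d))
^-≡+multiple (suc k) x d z with ^-≡+multiple k x d z
... | q , eq = x ℕ.* q ℕ.+ z ℕ.* (x ℕ.^ k ℕ.+ d ℕ.* q) , trans (cong ((x ℕ.+ d ℕ.* z) ℕ.*_) eq) (lem x d z (x ℕ.^ k) q)
  where
  lem : ∀ x d z e q → (x ℕ.+ d ℕ.* z) ℕ.* (e ℕ.+ d ℕ.* q) ≡ x ℕ.* e ℕ.+ d ℕ.* (x ℕ.* q ℕ.+ z ℕ.* (e ℕ.+ d ℕ.* q))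
  lem = ℕ-solve-∀

*-distrib-^ : ∀ k a b → (a ℕ.* b) ℕ.^ k ≡ a ℕ.^ k ℕ.* b ℕ.^ k
*-distrib-^ zero    a b = refl
*-distrib-^ (suc k) a b = trans (cong (a ℕ.* b ℕ.*_) (*-distrib-^ k a b)) (lem a b (a ℕ.^ k) (b ℕ.^ k))
  where
  lem : ∀ a b c d → a ℕ.* b ℕ.* (c ℕ.* d) ≡ a ℕ.* c ℕ.* (b ℕ.* d)
  lem = ℕ-solve-∀

prime∤⇒coprime : ∀ {p a} → Prime p → ¬ p ∣ a → Coprime a p
prime∤⇒coprime {p} pp p∤a (d∣a , d∣p) with prime⇒irreducible pp d∣p
... | inj₁ d≡1 = d≡1
... | inj₂ refl = contradiction d∣a p∤a

-- Multiplication by a permutes the residues mod p, so (aˡ − 1) Sₗ(p) ≡ 0 mod p.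
∤powerSum⇒^≡1 : ∀ {p} → Prime p → ∀ l → ¬ p ∣ powerSum l p → ∀ a → ¬ p ∣ a → ∃ λ q → a ℕ.^ l ≡ 1 ℕ.+ p ℕ.* q
∤powerSum⇒^≡1 {p} pp l p∤S a p∤a = conclude p∣w
  where
  instance
    p≢0 : ℕ.NonZero p
    p≢0 = prime⇒nonZero pp
    a≢0 : ℕ.NonZero a
    a≢0 = ℕ.≢-nonZero λ { refl → p∤a (p Div.∣0) }
  -- Since a is nonzero, aˡ is positive and w is truly aˡ - 1.
  w = ℕ.pred (a ℕ.^ l)
  S = ∑ℕ p (ℕ._^ l)

  1+w≡ : suc w ≡ a ℕ.^ l
  1+w≡ = ℕₚ.suc-pred (a ℕ.^ l) {{ℕₚ.m^n≢0 a l}}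

  reduce : ∀ j → ∃ λ q → (a ℕ.* j) ℕ.^ l ≡ ((a ℕ.* j) % p) ℕ.^ l ℕ.+ p ℕ.* q
  reduce j with ^-≡+multiple l ((a ℕ.* j) % p) p ((a ℕ.* j) DM./ p)
  ... | q , eq = q , trans (cong (ℕ._^ l) (trans (m≡m%n+[m/n]*n (a ℕ.* j) p) (cong ((a ℕ.* j) % p ℕ.+_) (ℕₚ.*-comm ((a ℕ.* j) DM./ p) p)))) eq

  p∣wS : (∃ λ q → ∑ℕ p (λ j → (a ℕ.* j) ℕ.^ l) ≡ ∑ℕ p (λ j → ((a ℕ.* j) % p) ℕ.^ l) ℕ.+ p ℕ.* q) → p ∣ w ℕ.* S
  p∣wS (q , eq) = divides q (trans (ℕₚ.+-cancelˡ-≡ S (w ℕ.* S) (p ℕ.* q) (begin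
    suc w ℕ.* S                                  ≡⟨ cong (ℕ._* S) 1+w≡ ⟩
    a ℕ.^ l ℕ.* S                                ≡⟨ sym (∑ℕ-* p (a ℕ.^ l) (ℕ._^ l)) ⟩
    ∑ℕ p (λ j → a ℕ.^ l ℕ.* j ℕ.^ l)             ≡⟨ ∑ℕ-cong p (λ j → sym (*-distrib-^ l a j)) ⟩
    ∑ℕ p (λ j → (a ℕ.* j) ℕ.^ l)                 ≡⟨ eq ⟩
    ∑ℕ p (λ j → ((a ℕ.* j) % p) ℕ.^ l) ℕ.+ p ℕ.* q ≡⟨ cong (ℕ._+ p ℕ.* q) (∑ℕ-*-% p (prime∤⇒coprime pp p∤a) (ℕ._^ l)) ⟩
    S ℕ.+ p ℕ.* q                                ∎)) (ℕₚ.*-comm p q))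

  p∣w : p ∣ w
  p∣w = [ id , (λ p∣S → contradiction (subst (p ∣_) (sym (powerSum≡∑ℕ l p)) p∣S) p∤S) ]′
    (euclidsLemma w S pp (p∣wS (∑ℕ-≡+multiple p p (λ j _ → reduce j))))

  conclude : p ∣ w → ∃ λ q → a ℕ.^ l ≡ 1 ℕ.+ p ℕ.* q
  conclude (divides q w≡) = q , trans (sym 1+w≡) (cong suc (trans w≡ (ℕₚ.*-comm q p)))

-- Doubling permutes the residues mod 2h + 1: the doubles of 0, …, h are the even numbers below
-- 2h + 1, and those of h + 1, …, 2h are the odd ones, shifted by 2h + 1.
doubling : ∀ h {f g : ℕ → ℕ} {c a d} → (∀ j → f (2 ℕ.* j) ≡ c ℕ.* f j) →
  (∀ x → ∃ λ q → f (x ℕ.+ suc (h ℕ.* 2)) ≡ f x ℕ.+ a ℕ.* g x ℕ.+ d ℕ.* q) →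
  ∃ λ q → c ℕ.* ∑ℕ (suc (h ℕ.* 2)) f ≡ ∑ℕ (suc (h ℕ.* 2)) f ℕ.+ (a ℕ.* ∑ℕ h (λ j → g (1 ℕ.+ 2 ℕ.* j)) ℕ.+ d ℕ.* q)
doubling h {f} {g} {c} {a} {d} double shift = q , (begin
  c ℕ.* ∑ℕ (suc (h ℕ.* 2)) f                              ≡⟨ sym (∑ℕ-* (suc (h ℕ.* 2)) c f) ⟩
  ∑ℕ (suc (h ℕ.* 2)) (λ j → c ℕ.* f j)                    ≡⟨ ∑ℕ-cong (suc (h ℕ.* 2)) (λ j → sym (double j)) ⟩
  ∑ℕ (suc (h ℕ.* 2)) (λ j → f (2 ℕ.* j))                  ≡⟨ cong (λ k → ∑ℕ k (λ j → f (2 ℕ.* j))) (lem₁ h) ⟩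
  ∑ℕ (suc h ℕ.+ h) (λ j → f (2 ℕ.* j))                    ≡⟨ ∑ℕ-split (suc h) h (λ j → f (2 ℕ.* j)) ⟩
  E ℕ.+ ∑ℕ h (λ j → f (2 ℕ.* (suc h ℕ.+ j)))              ≡⟨ cong (E ℕ.+_) (proj₂ expand) ⟩
  E ℕ.+ (∑ℕ h (λ j → f (odd j) ℕ.+ a ℕ.* g (odd j)) ℕ.+ d ℕ.* q)
    ≡⟨ cong (λ u → E ℕ.+ (u ℕ.+ d ℕ.* q)) (trans (∑ℕ-+ h (f ∘ odd) (λ j → a ℕ.* g (odd j))) (cong (O ℕ.+_) (∑ℕ-* h a (g ∘ odd)))) ⟩
  E ℕ.+ (O ℕ.+ a ℕ.* ∑ℕ h (g ∘ odd) ℕ.+ d ℕ.* q)          ≡⟨ lem₂ E O (a ℕ.* ∑ℕ h (g ∘ odd)) (d ℕ.* q) ⟩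
  E ℕ.+ O ℕ.+ (a ℕ.* ∑ℕ h (g ∘ odd) ℕ.+ d ℕ.* q)
    ≡⟨ cong (ℕ._+ (a ℕ.* ∑ℕ h (g ∘ odd) ℕ.+ d ℕ.* q)) (sym (∑ℕ-even-odd h f)) ⟩
  ∑ℕ (suc (h ℕ.* 2)) f ℕ.+ (a ℕ.* ∑ℕ h (g ∘ odd) ℕ.+ d ℕ.* q) ∎)
  where
  odd : ℕ → ℕ
  odd j = 1 ℕ.+ 2 ℕ.* j
  E O : ℕ
  E = ∑ℕ (suc h) (λ j → f (2 ℕ.* j))
  O = ∑ℕ h (f ∘ odd)
  lem₀ : ∀ h j → 2 ℕ.* (1 ℕ.+ h ℕ.+ j) ≡ (1 ℕ.+ 2 ℕ.* j) ℕ.+ (1 ℕ.+ h ℕ.* 2)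
  lem₀ = ℕ-solve-∀
  lem₁ : ∀ h → 1 ℕ.+ h ℕ.* 2 ≡ 1 ℕ.+ h ℕ.+ h
  lem₁ = ℕ-solve-∀
  lem₂ : ∀ a b c d → a ℕ.+ (b ℕ.+ c ℕ.+ d) ≡ a ℕ.+ b ℕ.+ (c ℕ.+ d)
  lem₂ = ℕ-solve-∀
  expand : ∃ λ q → ∑ℕ h (λ j → f (2 ℕ.* (suc h ℕ.+ j))) ≡ ∑ℕ h (λ j → f (odd j) ℕ.+ a ℕ.* g (odd j)) ℕ.+ d ℕ.* q
  expand = ∑ℕ-≡+multiple h d λ j _ → proj₁ (shift (odd j)) , trans (cong f (lem₀ h j)) (proj₂ (shift (odd j)))
  q : ℕ
  q = proj₁ expand

^≡1⇒^suc≡ : ∀ {p l} x → (∃ λ q → x ℕ.^ l ≡ 1 ℕ.+ p ℕ.* q) → ∃ λ q → x ℕ.^ suc l ≡ x ℕ.+ p ℕ.* q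
^≡1⇒^suc≡ {p} x (q , eq) = x ℕ.* q , trans (cong (x ℕ.*_) eq) (lem x p q)
  where
  lem : ∀ x p q → x ℕ.* (1 ℕ.+ p ℕ.* q) ≡ x ℕ.+ p ℕ.* (x ℕ.* q)
  lem = ℕ-solve-∀

odd-∤ : ∀ {h j} → j ℕ.< h → ¬ suc (h ℕ.* 2) ∣ 1 ℕ.+ 2 ℕ.* j
odd-∤ {h} {j} j<h p∣odd = ℕₚ.<⇒≱ odd<p (Div.∣⇒≤ {n = 1 ℕ.+ 2 ℕ.* j} p∣odd)
  where
  odd<p : 1 ℕ.+ 2 ℕ.* j ℕ.< suc (h ℕ.* 2)
  odd<p = s≤s (subst (1 ℕ.+ 2 ℕ.* j ℕ.≤_) (ℕₚ.*-comm 2 h) (ℕₚ.*-monoʳ-< 2 j<h))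

∑ℕ-odd-^ : ∀ h l → (∀ a → ¬ suc (h ℕ.* 2) ∣ a → ∃ λ q → a ℕ.^ l ≡ 1 ℕ.+ suc (h ℕ.* 2) ℕ.* q) →
  ∃ λ q → ∑ℕ h (λ j → (1 ℕ.+ 2 ℕ.* j) ℕ.^ suc l) ≡ h ℕ.* h ℕ.+ suc (h ℕ.* 2) ℕ.* q
∑ℕ-odd-^ h l unit = proj₁ reduced , trans (proj₂ reduced) (cong (ℕ._+ p ℕ.* proj₁ reduced) (∑ℕ-odd h))
  where
  p = suc (h ℕ.* 2)
  reduced : ∃ λ q → ∑ℕ h (λ j → (1 ℕ.+ 2 ℕ.* j) ℕ.^ suc l) ≡ ∑ℕ h (λ j → 1 ℕ.+ 2 ℕ.* j) ℕ.+ p ℕ.* q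
  reduced = ∑ℕ-≡+multiple h p λ j j<h → ^≡1⇒^suc≡ {p} {l} (1 ℕ.+ 2 ℕ.* j) (unit (1 ℕ.+ 2 ℕ.* j) (odd-∤ j<h))

-- Both c S and S are multiples of p², hence so is n p d; one factor p cancels, and d ≡ k mod p.
∣-from-doubling : ∀ {p S c n k d q q′} .{{_ : ℕ.NonZero p}} → p ℕ.* p ∣ S → d ≡ k ℕ.+ p ℕ.* q′ →
  c ℕ.* S ≡ S ℕ.+ ((n ℕ.* p) ℕ.* d ℕ.+ (p ℕ.* p) ℕ.* q) → p ∣ n ℕ.* k
∣-from-doubling {p} {S} {c} {n} {k} {q = q} {q′} p²∣S refl eq = *-cancelˡ-∣ p
  (∣m+n∣m⇒∣n (subst (p ℕ.* p ∣_) (lem n p k q q′) (∣m+n∣m⇒∣n (subst (p ℕ.* p ∣_) eq (∣-trans p²∣S (n∣m*n c))) p²∣S))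
    (m∣m*n (n ℕ.* q′ ℕ.+ q)))
  where
  lem : ∀ n p k q q′ → (n ℕ.* p) ℕ.* (k ℕ.+ p ℕ.* q′) ℕ.+ (p ℕ.* p) ℕ.* q ≡ p ℕ.* p ℕ.* (n ℕ.* q′ ℕ.+ q) ℕ.+ p ℕ.* (n ℕ.* k)
  lem = ℕ-solve-∀

^-shift : ∀ n x y → ∃ λ q → (x ℕ.+ y) ℕ.^ suc n ≡ x ℕ.^ suc n ℕ.+ (suc n ℕ.* y) ℕ.* x ℕ.^ n ℕ.+ y ℕ.* y ℕ.* q
^-shift n x y = q , trans eq (cong (λ u → x ℕ.^ suc n ℕ.+ u ℕ.+ y ℕ.* y ℕ.* q) (lem (suc n) (x ℕ.^ n) y))
  where
  q = proj₁ (^-expand n x y)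
  eq = proj₂ (^-expand n x y)
  lem : ∀ n x y → n ℕ.* x ℕ.* y ≡ n ℕ.* y ℕ.* x
  lem = ℕ-solve-∀

-- Voronoi's congruence with multiplier 2: (2ⁿ − 1) Sₙ(p) ≡ n p Σ (2j+1)ⁿ⁻¹ mod p², the sum being over
-- the odd numbers below p. If aⁿ⁻² ≡ 1 mod p for all units a, that sum is ≡ Σ (2j+1) = ((p−1)/2)².
voronoi : ∀ {p} h → p ≡ suc (h ℕ.* 2) → ∀ l → (∀ a → ¬ p ∣ a → ∃ λ q → a ℕ.^ l ≡ 1 ℕ.+ p ℕ.* q) →
  p ℕ.* p ∣ ∑ℕ p (ℕ._^ (2 ℕ.+ l)) → p ∣ (2 ℕ.+ l) ℕ.* (h ℕ.* h)
voronoi {p} h refl l unit p²∣S =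
  ∣-from-doubling {p} {∑ℕ p (λ x → x ℕ.^ n)} {2 ℕ.^ n} {n} {h ℕ.* h}
    {∑ℕ h (λ j → (1 ℕ.+ 2 ℕ.* j) ℕ.^ suc l)} {proj₁ doubled} {proj₁ odd-powers}
    p²∣S (proj₂ odd-powers) (proj₂ doubled)
  where
  n = 2 ℕ.+ l
  odd-powers = ∑ℕ-odd-^ h l unit
  doubled = doubling h {λ x → x ℕ.^ n} {λ x → x ℕ.^ suc l} {2 ℕ.^ n} {n ℕ.* p} {p ℕ.* p}
    (*-distrib-^ n 2) (λ x → ^-shift (suc l) x p)

-- The factor h² left by Voronoi's congruence is prime to p because 0 < h < p.
p²∣powerSum⇒p∣n : ∀ {p} → Prime p → ∀ h .{{_ : ℕ.NonZero h}} → p ≡ suc (h ℕ.* 2) → ∀ l →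
  (∀ a → ¬ p ∣ a → ∃ λ q → a ℕ.^ l ≡ 1 ℕ.+ p ℕ.* q) →
  p ℕ.* p ∣ powerSum (2 ℕ.+ l) p → p ∣ 2 ℕ.+ l
p²∣powerSum⇒p∣n {p} pp h p≡ l unit p²∣S =
  [ id , (λ p∣h² → contradiction ([ id , id ]′ (euclidsLemma h h pp p∣h²)) p∤h) ]′
    (euclidsLemma (2 ℕ.+ l) (h ℕ.* h) pp (voronoi h p≡ l unit (subst (p ℕ.* p ∣_) (powerSum≡∑ℕ (2 ℕ.+ l) p) p²∣S)))
  where
  p∤h : ¬ p ∣ h
  p∤h p∣h = ℕₚ.<⇒≱ (s≤s (ℕₚ.m≤m*n h 2)) (subst (ℕ._≤ h) p≡ (Div.∣⇒≤ p∣h))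

-- The two criteria

-- When the tail vanishes mod m^(k+1), the power sum is congruent to m Bₙ there, and one factor m
-- cancels. For k = 0 the right side is plain integrality of Bₙ at m.
powerSum⇔bernoulli : ∀ m k n .{{_ : ℕ.NonZero m}} → LocalMultiple m (m ℕ.^ suc k) (faulhaberTail m n) →
  (m ℕ.^ suc k ∣ powerSum n m) ⇔ LocalMultiple m (m ℕ.^ k) (bernoulli n)
powerSum⇔bernoulli m k n tail = mk⇔
  (λ m^∣S → lm-cancel-* m (lm-cancel-+ʳ
    (subst (LocalMultiple m (m ℕ.^ suc k)) (powerSum-split m n) (∣⇒lm-ν m^∣S)) tail))
  (λ h → lm-ν⇒∣ m (suc k) (subst (LocalMultiple m (m ℕ.^ suc k)) (sym (powerSum-split m n))
    (lm-+ (lm-* lm-ν h) tail)))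

powerSum⇔bernoulli-integral : ∀ m n .{{_ : ℕ.NonZero m}} → 2 ∣ n →
  (m ℕ.^ 1 ∣ powerSum n m) ⇔ LocalMultiple m 1 (bernoulli n)
powerSum⇔bernoulli-integral m n 2∣n = powerSum⇔bernoulli m 0 n
  (subst (λ t → LocalMultiple m t (faulhaberTail m n)) (sym (ℕₚ.*-identityʳ m)) (tail-mod-m m n 2∣n))

-- The moduli 2 and 3

2^even≡1[3] : ∀ q → ∃ λ k → 2 ℕ.^ (q ℕ.* 2) ≡ 1 ℕ.+ k ℕ.* 3
2^even≡1[3] zero    = 0 , refl
2^even≡1[3] (suc q) with 2^even≡1[3] q
... | k , eq = 1 ℕ.+ 4 ℕ.* k , trans (cong (λ x → 2 ℕ.* (2 ℕ.* x)) eq) (lem k)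
  where
  lem : ∀ k → 2 ℕ.* (2 ℕ.* (1 ℕ.+ k ℕ.* 3)) ≡ 1 ℕ.+ (1 ℕ.+ 4 ℕ.* k) ℕ.* 3
  lem = ℕ-solve-∀

-- For a positive exponent the sum is 0 + 1 = 1.
2∤powerSum : ∀ n → ¬ 2 ∣ powerSum (suc n) 2
2∤powerSum n 2∣S with Div.∣⇒≤ (subst (2 ∣_) (trans (ℕₚ.+-identityʳ (1 ℕ.^ suc n)) (ℕₚ.^-zeroˡ (suc n))) 2∣S)
... | s≤s ()

-- For an even exponent 2ⁿ ≡ 1 mod 3, so the sum is 1 + 2ⁿ ≡ 2.
3∤powerSum : ∀ q → ¬ 3 ∣ powerSum (suc q ℕ.* 2) 3
3∤powerSum q 3∣S with 2^even≡1[3] (suc q)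
... | k , eq with Div.∣⇒≤ (Div.∣m+n∣m⇒∣n (subst (3 ∣_) (begin
    1 ℕ.^ n ℕ.+ (2 ℕ.^ n ℕ.+ 0)   ≡⟨ cong₂ ℕ._+_ (ℕₚ.^-zeroˡ n) (ℕₚ.+-identityʳ (2 ℕ.^ n)) ⟩
    1 ℕ.+ 2 ℕ.^ n                 ≡⟨ cong suc eq ⟩
    2 ℕ.+ k ℕ.* 3                 ≡⟨ ℕₚ.+-comm 2 (k ℕ.* 3) ⟩
    k ℕ.* 3 ℕ.+ 2                 ∎) 3∣S) (n∣m*n k))
    where n = suc q ℕ.* 2
... | s≤s (s≤s ())

-- As in von Staudt-Clausen, 2 and 3 divide the denominator of Bₙ for every even n > 0, since p - 1
-- ∣ n for both. If such a p divided m, then Bₙ would be integral at p and p would divide Sₙ(p).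
bernoulli-integral⇒5-rough : ∀ m q → LocalMultiple m 1 (bernoulli (suc q ℕ.* 2)) → 5 Rough m
bernoulli-integral⇒5-rough m q h = ∤⇒rough-suc (λ 4∣m → 2∤m (∣-trans (divides 2 refl) 4∣m))
  (∤⇒rough-suc 3∤m (∤⇒rough-suc 2∤m 2-rough))
  where
  n = suc q ℕ.* 2
  ∤m : ∀ p .{{_ : ℕ.NonZero p}} → ¬ p ∣ powerSum n p → ¬ p ∣ m
  ∤m p p∤S p∣m = p∤S (∣-trans (m∣m*n 1)
    (Equivalence.from (powerSum⇔bernoulli-integral p n (n∣m*n (suc q))) (lm-restrict p∣m h)))
  2∤m : ¬ 2 ∣ m
  2∤m = ∤m 2 (2∤powerSum (suc (q ℕ.* 2)))
  3∤m : ¬ 3 ∣ m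
  3∤m = ∤m 3 (3∤powerSum q)

-- Integrality of n Bₙ₋₂ at the primes dividing m

prime-divisor : ∀ n → ∃ λ p → Prime p × p ∣ suc (suc n)
prime-divisor n with factorise (suc (suc n))
... | record { factors = p ∷ ps ; isFactorisation = eq ; factorsPrime = pp ∷ _ } = p , pp , subst (p ∣_) (sym eq) (m∣m*n _)

-- A common factor of the denominator and m other than 1 has a prime divisor. This reduces the
-- question to prime moduli, where Euclid's lemma is available.
lm-primewise : ∀ m .{{_ : ℕ.NonZero m}} x → (∀ p → Prime p → p ∣ m → LocalMultiple p 1 x) → LocalMultiple m 1 x
lm-primewise m x h = coprime-↧⇒lm x coprime
  where
  coprime : Coprime (↧ₙ x) m
  coprime {0}           (_ , 0∣m)     = contradiction (Div.0∣⇒≡0 0∣m) (ℕ.≢-nonZero⁻¹ m)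
  coprime {1}           _             = refl
  coprime {suc (suc e)} (e∣↧ , e∣m) with prime-divisor e
  ... | p , pp , p∣e = contradiction
    (lm⇒coprime-↧ (h p pp (∣-trans p∣e e∣m)) (∣-trans p∣e e∣↧ , ∣-refl))
    (ℕ.nonTrivial⇒≢1 {{prime⇒nonTrivial pp}})

parity : ∀ n → 2 ∣ n ⊎ ∃ λ h → n ≡ suc (h ℕ.* 2)
parity zero          = inj₁ (divides 0 refl)
parity (suc zero)    = inj₂ (0 , refl)
parity (suc (suc n)) with parity n
... | inj₁ (divides q eq) = inj₁ (divides (suc q) (cong (2 ℕ.+_) eq))
... | inj₂ (h , eq)       = inj₂ (suc h , cong (2 ℕ.+_) eq)

lm-ν*-bernoulli : ∀ {p n} l → p ∣ n → LocalMultiple p 1 (ν n ⊗ bernoulli l)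
lm-ν*-bernoulli {p} l (divides q refl) = subst (LocalMultiple p 1) (begin
  ν q ⊗ (ν p ⊗ bernoulli l)    ≡⟨ sym (ℚₚ.*-assoc (ν q) (ν p) (bernoulli l)) ⟩
  ν q ⊗ ν p ⊗ bernoulli l      ≡⟨ cong (_⊗ bernoulli l) (sym (ν-* q p)) ⟩
  ν (q ℕ.* p) ⊗ bernoulli l    ∎) (lm-scale (+ q) (bernoulli-integral p l))

5-rough⇒odd : ∀ {p} → 5 Rough p → p ≢ 1 → ∃ λ h → ℕ.NonZero h × p ≡ suc (h ℕ.* 2)
5-rough⇒odd {p} rough p≢1 with parity p
... | inj₁ 2∣p             = contradiction (rough⇒≤ (rough∧∣⇒rough rough 2∣p)) (ℕₚ.<⇒≱ (s≤s (s≤s (s≤s z≤n))))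
... | inj₂ (zero , p≡1)    = contradiction p≡1 p≢1
... | inj₂ (suc h , p≡)    = suc h , _ , p≡

-- Either Bₗ is itself integral at p, or p ∣ n and this factor p absorbs its denominator, p Bₗ being
-- integral.
n-bernoulli-integral : ∀ {p} → Prime p → 5 Rough p → ∀ j → let l = suc j ℕ.* 2 in
  LocalMultiple p (p ℕ.^ 1) (bernoulli (2 ℕ.+ l)) → LocalMultiple p 1 (ν (2 ℕ.+ l) ⊗ bernoulli l)
n-bernoulli-integral {p} pp rough j h = cases (p Div.∣? powerSum l p)
  where
  l = suc j ℕ.* 2
  n = 2 ℕ.+ l
  instance
    p≢0 : ℕ.NonZero p
    p≢0 = prime⇒nonZero pp

  p²∣S : p ℕ.* p ∣ powerSum n p
  p²∣S = subst (_∣ powerSum n p) (cong (p ℕ.*_) (ℕₚ.*-identityʳ p))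
    (Equivalence.from (powerSum⇔bernoulli p 1 n (tail-mod-m² rough (suc j))) h)

  cases : Dec (p ∣ powerSum l p) → LocalMultiple p 1 (ν n ⊗ bernoulli l)
  cases (yes p∣S) = lm-scale (+ n) (Equivalence.to (powerSum⇔bernoulli-integral p l (n∣m*n (suc j)))
    (subst (_∣ powerSum l p) (sym (ℕₚ.*-identityʳ p)) p∣S))
  cases (no  p∤S) = let k , k≢0 , p≡ = 5-rough⇒odd rough (ℕ.nonTrivial⇒≢1 {{prime⇒nonTrivial pp}}) in
    lm-ν*-bernoulli l (p²∣powerSum⇒p∣n pp k {{k≢0}} p≡ l (∤powerSum⇒^≡1 pp l p∤S) p²∣S)

module _ (m : ℕ) .{{_ : ℕ.NonZero m}} where

  -- The tail estimate presupposes m prime to 6, so each direction extracts this from its own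
  -- hypothesis: either one makes Bₙ integral at m.
  square-criterion : ∀ q → let n = suc q ℕ.* 2 in (m ℕ.^ 2 ∣ powerSum n m) ⇔ (m ℕ.^ 1 ∣ ℤ.∣ ↥ bernoulli n ∣)
  square-criterion q = mk⇔
    (λ m²∣S → let rough = bernoulli-integral⇒5-rough m q
                    (Equivalence.to (powerSum⇔bernoulli-integral m n (n∣m*n (suc q))) (∣-trans (divides m refl) m²∣S))
      in lm⇒∣↥ m 1 (Equivalence.to (powerSum⇔bernoulli m 1 n (tail-mod-m² rough q)) m²∣S))
    (λ m∣B → let h = ∣↥⇒lm m 0 (bernoulli n) m∣B
      in Equivalence.from (powerSum⇔bernoulli m 1 n (tail-mod-m² (bernoulli-integral⇒5-rough m q (lm-weaken (1∣ _) h)) q)) h)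
    where n = suc q ℕ.* 2

  bernoulli⇒tail-mod-m³ : ∀ j → let n = suc (suc j) ℕ.* 2 in m ℕ.^ 1 ∣ ℤ.∣ ↥ bernoulli n ∣ →
    LocalMultiple m (m ℕ.^ 3) (faulhaberTail m n)
  bernoulli⇒tail-mod-m³ j m∣B = tail-mod-m³ rough j (lm-primewise m (ν (2 ℕ.+ suc j ℕ.* 2) ⊗ bernoulli (suc j ℕ.* 2)) λ p pp p∣m →
    n-bernoulli-integral pp (rough∧∣⇒rough rough p∣m) j
      (lm-weaken (subst₂ _∣_ (sym (ℕₚ.*-identityʳ p)) (sym (ℕₚ.*-identityʳ m)) p∣m) (lm-restrict p∣m h)))
    where
    h : LocalMultiple m (m ℕ.^ 1) (bernoulli (suc (suc j) ℕ.* 2))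
    h = ∣↥⇒lm m 0 (bernoulli (suc (suc j) ℕ.* 2)) m∣B
    rough : 5 Rough m
    rough = bernoulli-integral⇒5-rough m (suc j) (lm-weaken (1∣ _) h)

  -- Either side implies m ∣ Bₙ, from the left by way of `square-criterion`, and m ∣ Bₙ is what the
  -- tail estimate mod m³ takes as input.
  cube-criterion : ∀ q → let n = suc q ℕ.* 2 in (m ℕ.^ 3 ∣ powerSum n m) ⇔ (m ℕ.^ 2 ∣ ℤ.∣ ↥ bernoulli n ∣)
  cube-criterion zero    = mk⇔
    (λ m³∣S → unit² (Equivalence.to (square-criterion 0) (∣-trans m²∣m³ m³∣S)) _)
    (λ m²∣B → unit³ (∣-trans m∣m² m²∣B) _)
    where
    m²∣m³ = divides m refl
    m∣m² = divides m refl
    m≡1 : m ℕ.^ 1 ∣ 1 → m ≡ 1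
    m≡1 m∣1 = trans (sym (ℕₚ.*-identityʳ m)) (Div.∣1⇒≡1 m∣1)
    unit² : m ℕ.^ 1 ∣ 1 → ∀ k → m ℕ.^ 2 ∣ k
    unit² m∣1 k = subst (λ m → m ℕ.^ 2 ∣ k) (sym (m≡1 m∣1)) (1∣ k)
    unit³ : m ℕ.^ 1 ∣ 1 → ∀ k → m ℕ.^ 3 ∣ k
    unit³ m∣1 k = subst (λ m → m ℕ.^ 3 ∣ k) (sym (m≡1 m∣1)) (1∣ k)
  cube-criterion (suc j) = mk⇔
    (λ m³∣S → lm⇒∣↥ m 2 (Equivalence.to (powerSum⇔bernoulli m 2 n
      (bernoulli⇒tail-mod-m³ j (Equivalence.to (square-criterion (suc j)) (∣-trans (divides m refl) m³∣S)))) m³∣S))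
    (λ m²∣B → Equivalence.from (powerSum⇔bernoulli m 2 n (bernoulli⇒tail-mod-m³ j (∣-trans (divides m refl) m²∣B)))
      (∣↥⇒lm m 1 (bernoulli n) m²∣B))
    where n = suc (suc j) ℕ.* 2

open import Data.Nat using (_^_; _+_; _≤_)

theorem5p5 : (n m r : ℕ) → 1 ≤ n → 1 ≤ m → 2 ∣ n → (r ≡ 1 ⊎ r ≡ 2) →
    ((m ^ (r + 1) ∣ powerSum n m) ⇔ ((+ (m ^ r)) ∣ℤ ↥ (bernoulli n)))
theorem5p5 _ m _ _  1≤m (divides (suc q) refl) (inj₁ refl) = square-criterion m {{ℕ.>-nonZero 1≤m}} q
theorem5p5 _ m _ _  1≤m (divides (suc q) refl) (inj₂ refl) = cube-criterion m {{ℕ.>-nonZero 1≤m}} q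
theorem5p5 _ _ _ () _   (divides zero refl)    _
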